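{- For all positive integers $r$ and $k$, if a graph $G$ does not contain $k$ vertex-disjoint copies of $K_{2,r}$ as minors, then $\mathbf{tw}(G) < 20k^2r^2 - 8k^2r + 2r - 1$.
   Context: Graphs are finite, simple, undirected. $\mathbf{tw}(G)$ denotes the treewidth of $G$. $K_{2,r}$ is the complete bipartite graph with parts of sizes $2$ and $r$. "$G$ contains $k$ disjoint copies of $K_{2,r}$ as minors" means $G$ contains the disjoint union of $k$ copies of $K_{2,r}$ as a minor. -}

module Defs where

open import Data.Nat using (ℕ; zero; suc; _+_; _*_; _∸_; _⊔_; _<ᵇ_; _<_)
open import Data.Empty using (⊥; ⊥-elim)
open import Data.Unit using (⊤)
open import Data.Bool.Properties using (∧-zeroʳ)
open import Data.Fin using (Fin; zero; suc; toℕ; inject₁; fromℕ; remQuot; _≟_)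
open import Data.Fin.Subset using (Subset; _∈_; ∣_∣)
open import Data.Bool using (Bool; true; false; _∧_; _xor_)
open import Data.Product using (Σ; ∃; ∃₂; _×_; _,_; proj₁; proj₂)
open import Data.Vec using (foldr; tabulate)
open import Relation.Nullary using (¬_; yes; no)
open import Relation.Nullary.Decidable using (⌊_⌋)
open import Relation.Binary.PropositionalEquality using (_≡_; _≢_; refl; cong; cong₂; trans)
open import Function.Definitions using (Injective)

record Graph : Set where
  field
    n      : ℕ
    adj    : Fin n → Fin n → Bool
    sym    : ∀ x y → adj x y ≡ adj y x
    irrefl : ∀ x → adj x x ≡ false
open Graph public

Edge : (G : Graph) → Fin (n G) → Fin (n G) → Set
Edge G x y = adj G x y ≡ true

data WalkIn (G : Graph) (P : Fin (n G) → Set) : Fin (n G) → Fin (n G) → Set where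
  here : ∀ {x} → P x → WalkIn G P x x
  step : ∀ {x y z} → P x → Edge G x y → WalkIn G P y z → WalkIn G P x z

ConnectedIn : (G : Graph) → (Fin (n G) → Set) → Set
ConnectedIn G P = ∀ x y → P x → P y → WalkIn G P x y

Everything : ∀ {m} → Fin m → Set
Everything _ = ⊤

Connected : Graph → Set
Connected G = ConnectedIn G Everything

record Cycle (G : Graph) : Set where
  field
    m      : ℕ
    c      : Fin (suc (suc (suc m))) → Fin (n G)
    inj    : Injective _≡_ _≡_ c
    edges  : ∀ (i : Fin (suc (suc m))) → Edge G (c (inject₁ i)) (c (suc i))
    closes : Edge G (c (fromℕ (suc (suc m)))) (c zero)

Acyclic : Graph → Set
Acyclic G = ¬ Cycle G

record IsTree (T : Graph) : Set where
  field
    nonempty  : Fin (n T)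
    connected : Connected T
    acyclic   : Acyclic T

record TreeDecomposition (G : Graph) : Set where
  field
    T        : Graph
    isTree   : IsTree T
    bag      : Fin (n T) → Subset (n G)
    covers   : ∀ v → ∃ λ t → v ∈ bag t
    edgeIn   : ∀ u v → Edge G u v → ∃ λ t → (u ∈ bag t) × (v ∈ bag t)
    coherent : ∀ v → ConnectedIn T (λ t → v ∈ bag t)

width : ∀ {G} → TreeDecomposition G → ℕ
width D = foldr (λ _ → ℕ) _⊔_ 0 (tabulate (λ t → ∣ TreeDecomposition.bag D t ∣)) ∸ 1

TreewidthLessThan : Graph → ℕ → Set
TreewidthLessThan G N = Σ (TreeDecomposition G) (λ D → width D < N)

record MinorModel (H G : Graph) : Set where
  field
    branch    : Fin (n H) → Subset (n G)
    nonempty  : ∀ v → ∃ λ x → x ∈ branch v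
    connected : ∀ v → ConnectedIn G (λ x → x ∈ branch v)
    disjoint  : ∀ u v → u ≢ v → ∀ x → x ∈ branch u → x ∈ branch v → ⊥
    edges     : ∀ u v → Edge H u v → ∃₂ λ x y → (x ∈ branch u) × (y ∈ branch v) × Edge G x y

_≼_ : Graph → Graph → Set
H ≼ G = MinorModel H G

-- The complete bipartite graph K_{2,r}: vertices 0,1 form one side,
-- vertices 2 .. r+1 the other.
private
  xor-comm : ∀ a b → a xor b ≡ b xor a
  xor-comm false false = refl
  xor-comm false true  = refl
  xor-comm true  false = refl
  xor-comm true  true  = refl

  xor-self : ∀ a → a xor a ≡ false
  xor-self false = refl
  xor-self true  = refl

  ≟-sym : ∀ {m} (a b : Fin m) → ⌊ a ≟ b ⌋ ≡ ⌊ b ≟ a ⌋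
  ≟-sym a b with a ≟ b | b ≟ a
  ... | yes _ | yes _ = refl
  ... | no _  | no _  = refl
  ... | yes refl | no q = ⊥-elim (q refl)
  ... | no p | yes refl = ⊥-elim (p refl)

K2 : ℕ → Graph
K2 r = record
  { n      = suc (suc r)
  ; adj    = λ i j → (toℕ i <ᵇ 2) xor (toℕ j <ᵇ 2)
  ; sym    = λ i j → xor-comm (toℕ i <ᵇ 2) (toℕ j <ᵇ 2)
  ; irrefl = λ i → xor-self (toℕ i <ᵇ 2)
  }

-- Disjoint union of k copies of H: vertex x of Fin (k * n H) is the pair
-- (copy, vertex) = remQuot (n H) x; two vertices are adjacent iff they lie
-- in the same copy and are adjacent in H.
copies : ℕ → Graph → Graph
copies k H = record
  { n      = k * n H
  ; adj    = A
  ; sym    = λ x y → cong₂ _∧_ (≟-sym (q x) (q y)) (sym H (p x) (p y))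
  ; irrefl = λ x → trans (cong (⌊ q x ≟ q x ⌋ ∧_) (irrefl H (p x))) (∧-zeroʳ _)
  }
  where
  q : Fin (k * n H) → Fin k
  q x = proj₁ (remQuot {k} (n H) x)
  p : Fin (k * n H) → Fin (n H)
  p x = proj₂ (remQuot {k} (n H) x)
  A : Fin (k * n H) → Fin (k * n H) → Bool
  A x y = ⌊ q x ≟ q y ⌋ ∧ adj H (p x) (p y)

{-# OPTIONS --safe #-}
module Submission where

-- Put m = 3k and M = 4k(r - 1) + 1. We decompose a vertex set C together with its boundary N(C), which is
-- covered by 2m disjoint connected sets outside C, m on either of two sides, each containing at most M
-- vertices of N(C). If one of the sets contains fewer than M, it absorbs a vertex of C, which leaves C through
-- a new bag. Otherwise each side contains exactly mM vertices of N(C). If mM disjoint paths through C join the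
-- two sides, then greedily choosing pairs of sets joined by at least r of the paths gives k disjoint copies of
-- K_{2,r}. If not, König's theorem yields a separator Z of at most mM vertices with disjoint paths from
-- Z to each side. With N(C) ∪ Z as a bag, the two parts of C - Z are treated recursively, the sets on the far
-- side of Z being prolonged along those paths; as distinct vertices of Z lead to distinct vertices of N(C), no
-- set gains boundary vertices. All bags have at most 3mM vertices.

open import Defs
open import Data.Nat using (ℕ; zero; suc; _+_; _*_; _∸_; _⊔_; _≤_; _<_; _≤?_; z≤n; s≤s)
open import Relation.Nullary using (¬_; Dec; yes; no; does; contradiction)
open import Data.Bool using (Bool; true; false)
import Data.Bool.Properties as Bool
open import Data.Empty as Empty using (⊥-elim)
open import Data.Fin using (Fin; zero; suc; _≟_; inject₁; fromℕ; punchIn; combine; remQuot)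
open import Data.Fin.Properties using (any?; ¬Fin0; suc-injective; 0≢1+n; punchIn-injective; punchInᵢ≢i; combine-remQuot)
open import Data.Fin.Subset
open import Data.Fin.Subset.Properties
open import Data.Maybe using (Maybe; just; nothing; maybe′)
open import Data.Maybe.Properties using (just-injective; ≡-dec)
open import Data.Nat.Properties hiding (_≟_; suc-injective; 0≢1+n)
open import Algebra.Properties.CommutativeMonoid.Sum +-0-commutativeMonoid using (sum; sum-remove; ∑-distrib-+; sum-cong-≗)
open import Data.Nat.Tactic.RingSolver using (solve-∀)
open import Data.Product using (∃; ∃₂; _×_; _,_; proj₁; proj₂)
import Data.Product.Properties as Product
open import Data.Sum using (_⊎_; inj₁; inj₂; [_,_]′)
open import Data.Unit using (tt)
open import Data.Vec using (foldr; tabulate; _∷_; []; here; there)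
open import Data.Vec.Properties using (lookup⇒[]=; []=⇒lookup; lookup∘tabulate)
open import Function using (_∘_; id)
open import Function.Definitions using (Injective)
open import Relation.Binary using () renaming (Decidable to Decidable₂)
open import Relation.Binary.PropositionalEquality using (_≡_; _≢_; refl; cong; subst; trans) renaming (sym to ≡-sym)
open import Relation.Nullary.Decidable using (¬?; _×-dec_; _⊎-dec_; decidable-stable; dec-true)
open import Relation.Unary using (Decidable)

-- The paths and the separator both come from a bipartite graph in which each vertex of C occurs
-- once on the left and once on the right, joined to itself by a loop. A vertex on no path can be
-- matched to itself, so a matching of the whole left side amounts to a system of disjoint paths.
-- The loop also forces every vertex cover to contain one of the two copies, and the vertices with
-- both copies in the cover form Z. The matching edges on either side of the cover are the disjoint
-- paths starting from Z. Progress is measured by C alone: both parts of C - Z are proper subsets of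
-- C, and for one of them this rests on the two sides being equally large. Each path gives its first
-- inner vertex as a vertex of degree two; the rest of it is absorbed by the class that it reaches.

private variable
  ν : ℕ

-- Finite sets

abstract
  subset : {P : Fin ν → Set} → Decidable P → Subset ν
  subset P? = tabulate (does ∘ P?)

  ∈-subset⁺ : {P : Fin ν → Set} (P? : Decidable P) {x : Fin ν} → P x → x ∈ subset P?
  ∈-subset⁺ P? {x} px =
    lookup⇒[]= x _ (trans (lookup∘tabulate (does ∘ P?) x) (dec-true (P? x) px))

  ∈-subset⁻ : {P : Fin ν → Set} (P? : Decidable P) {x : Fin ν} → x ∈ subset P? → P x
  ∈-subset⁻ P? {x} x∈ with P? x | trans (≡-sym (lookup∘tabulate (does ∘ P?) x)) ([]=⇒lookup x∈)
  ... | yes px | _ = px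
  ... | no _ | ()

∣∪∣≤ : (p q : Subset ν) → ∣ p ∪ q ∣ ≤ ∣ p ∣ + ∣ q ∣
∣∪∣≤ [] [] = z≤n
∣∪∣≤ (false ∷ p) (false ∷ q) = ∣∪∣≤ p q
∣∪∣≤ (false ∷ p) (true ∷ q) = ≤-trans (s≤s (∣∪∣≤ p q)) (≤-reflexive (≡-sym (+-suc _ _)))
∣∪∣≤ (true ∷ p) (false ∷ q) = s≤s (∣∪∣≤ p q)
∣∪∣≤ (true ∷ p) (true ∷ q) = s≤s (≤-trans (∣∪∣≤ p q) (+-monoʳ-≤ _ (n≤1+n _)))

∪-disjoint-≤ : (p q : Subset ν) → (∀ {x} → x ∈ p → x ∉ q) → ∣ p ∣ + ∣ q ∣ ≤ ∣ p ∪ q ∣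
∪-disjoint-≤ [] [] d = z≤n
∪-disjoint-≤ (false ∷ p) (false ∷ q) d = ∪-disjoint-≤ p q (λ x y → d (there x) (there y))
∪-disjoint-≤ (false ∷ p) (true ∷ q) d =
  ≤-trans (≤-reflexive (+-suc _ _)) (s≤s (∪-disjoint-≤ p q (λ x y → d (there x) (there y))))
∪-disjoint-≤ (true ∷ p) (false ∷ q) d = s≤s (∪-disjoint-≤ p q (λ x y → d (there x) (there y)))
∪-disjoint-≤ (true ∷ p) (true ∷ q) d = ⊥-elim (d here here)

-- Induction on `p`: the image of the first element is removed from `q`, and injectivity keeps the
-- other images in what is left.
card-injection : ∀ {μ} (p : Subset ν) (q : Subset μ) (f : Fin ν → Fin μ) →
  (∀ {x} → x ∈ p → f x ∈ q) → (∀ {x y} → x ∈ p → y ∈ p → f x ≡ f y → x ≡ y) → ∣ p ∣ ≤ ∣ q ∣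
card-injection [] q f into inj = z≤n
card-injection (false ∷ p) q f into inj =
  card-injection p q (f ∘ suc) (into ∘ there) (λ a b e → suc-injective (inj (there a) (there b) e))
card-injection (true ∷ p) q f into inj =
  ≤-<-trans
    (card-injection p (q - f zero) (f ∘ suc)
      (λ a → x∈p∧x≢y⇒x∈p-y (into (there a)) (λ e → 0≢1+n (≡-sym (inj (there a) here e))))
      (λ a b e → suc-injective (inj (there a) (there b) e)))
    (x∈p⇒∣p-x∣<∣p∣ (into here))

pick : (p : Subset ν) {r : ℕ} → r ≤ ∣ p ∣ → ∃ λ (g : Fin r → Fin ν) → Injective _≡_ _≡_ g × (∀ i → g i ∈ p)
pick p {zero} _ = (λ ()) , (λ {}) , λ ()
pick (false ∷ p) {suc r} r≤ = let g , inj , g∈ = pick p r≤ in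
  suc ∘ g , inj ∘ suc-injective , there ∘ g∈
pick (true ∷ p) {suc r} (s≤s r≤) = let g , inj , g∈ = pick p r≤ in
  (λ { zero → zero ; (suc i) → suc (g i) }) ,
  (λ { {zero} {zero} _ → refl ; {suc i} {suc j} e → cong suc (inj (suc-injective e)) }) ,
  (λ { zero → here ; (suc i) → there (g∈ i) })

sum-mono : ∀ {m} {f g : Fin m → ℕ} → (∀ i → f i ≤ g i) → sum f ≤ sum g
sum-mono {zero} _ = z≤n
sum-mono {suc m} h = +-mono-≤ (h zero) (sum-mono (h ∘ suc))

sum-const : ∀ m c → sum {m} (λ _ → c) ≡ m * c
sum-const zero c = refl
sum-const (suc m) c = cong (c +_) (sum-const m c)

∈─⇒∉ : (p q : Subset ν) {x : Fin ν} → x ∈ p ─ q → x ∉ q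
∈─⇒∉ (_ ∷ p) (_ ∷ q) (there a) (there b) = ∈─⇒∉ p q a b
∈─⇒∉ (_ ∷ p) (.true ∷ q) () here

∉-remove : {p : Subset ν} {x : Fin ν} → x ∉ p - x
∉-remove {p = p} {x} x∈ = ∈─⇒∉ p ⁅ x ⁆ x∈ (x∈⁅x⁆ x)

remove-⊆ : {p : Subset ν} {x : Fin ν} → p - x ⊆ p
remove-⊆ {p = p} {x} = p─q⊆p p ⁅ x ⁆

card-cover : ∀ {m} (p : Subset ν) (q : Fin m → Subset ν) →
  (∀ {x} → x ∈ p → ∃ λ i → x ∈ q i) → ∣ p ∣ ≤ sum (λ i → ∣ q i ∣)
card-cover {ν = ν} {m = zero} p q cov =
  ≤-reflexive (trans (cong ∣_∣ (Empty-unique (λ (x , x∈) → ¬Fin0 (proj₁ (cov x∈))))) (∣⊥∣≡0 ν))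
card-cover {m = suc m} p q cov =
  ≤-trans (p⊆q⇒∣p∣≤∣q∣ split)
  (≤-trans (∣∪∣≤ (q zero) (p ─ q zero)) (+-monoʳ-≤ _ (card-cover (p ─ q zero) (q ∘ suc) cov′)))
  where
  split : p ⊆ q zero ∪ (p ─ q zero)
  split {x} x∈ with x ∈? q zero
  ... | yes x∈q = p⊆p∪q _ x∈q
  ... | no x∉q = q⊆p∪q _ _ (x∈p∧x∉q⇒x∈p─q x∈ x∉q)
  cov′ : ∀ {x} → x ∈ p ─ q zero → ∃ λ i → x ∈ q (suc i)
  cov′ {x} x∈ with cov (p─q⊆p p (q zero) x∈)
  ... | suc i , x∈q = i , x∈q
  ... | zero , x∈q = ⊥-elim (∈─⇒∉ p (q zero) x∈ x∈q)

card-packing : ∀ {m} (p : Subset ν) (q : Fin m → Subset ν) → (∀ i → q i ⊆ p) →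
  (∀ {i j x} → x ∈ q i → x ∈ q j → i ≡ j) → sum (λ i → ∣ q i ∣) ≤ ∣ p ∣
card-packing {m = zero} p q sub dis = z≤n
card-packing {m = suc m} p q sub dis =
  ≤-trans (+-monoʳ-≤ _ (card-packing ⋃q (q ∘ suc) (λ i {x} x∈ → ∈-subset⁺ ⋃q? (i , x∈)) (λ a b → suc-injective (dis a b))))
  (≤-trans (∪-disjoint-≤ (q zero) ⋃q (λ a b → let j , b′ = ∈-subset⁻ ⋃q? b in 0≢1+n (dis a b′)))
   (p⊆q⇒∣p∣≤∣q∣ (λ x∈ → back (x∈p∪q⁻ (q zero) ⋃q x∈))))
  where
  ⋃q? : Decidable (λ x → ∃ λ (i : Fin m) → x ∈ q (suc i))
  ⋃q? x = any? (λ i → x ∈? q (suc i))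
  ⋃q : Subset _
  ⋃q = subset ⋃q?
  back : ∀ {x} → x ∈ q zero ⊎ x ∈ ⋃q → x ∈ p
  back (inj₁ a) = sub zero a
  back (inj₂ b) = let j , b′ = ∈-subset⁻ ⋃q? b in sub (suc j) b′

-- Heavy entries of a matrix

-- Only an inequality, as the entry at (i₀, j₀) is counted in its row and again in its column.
sum-minor : ∀ {m} (a : Fin (suc m) → Fin (suc m) → ℕ) i₀ j₀ →
  sum (sum ∘ a) ≤ sum (a i₀) + sum (λ i → a i j₀) + sum (λ i → sum (λ j → a (punchIn i₀ i) (punchIn j₀ j)))
sum-minor a i₀ j₀ = begin
  sum (sum ∘ a)                                    ≡⟨ sum-remove {i = i₀} (sum ∘ a) ⟩
  sum (a i₀) + sum rest                            ≡⟨ cong (sum (a i₀) +_) (trans (sum-cong-≗ (λ i → sum-remove {i = j₀} (a (punchIn i₀ i)))) (∑-distrib-+ col inner)) ⟩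
  sum (a i₀) + (sum col + sum inner)               ≡⟨ ≡-sym (+-assoc (sum (a i₀)) (sum col) (sum inner)) ⟩
  sum (a i₀) + sum col + sum inner                 ≤⟨ +-monoˡ-≤ (sum inner) (+-monoʳ-≤ (sum (a i₀)) col≤) ⟩
  sum (a i₀) + sum (λ i → a i j₀) + sum inner      ∎
  where
  open ≤-Reasoning
  rest inner col : Fin _ → ℕ
  rest i = sum (a (punchIn i₀ i))
  inner i = sum (λ j → a (punchIn i₀ i) (punchIn j₀ j))
  col i = a (punchIn i₀ i) j₀
  col≤ : sum col ≤ sum (λ i → a i j₀)
  col≤ = ≤-trans (m≤n+m (sum col) (a i₀ j₀)) (≤-reflexive (≡-sym (sum-remove {i = i₀} (λ i → a i j₀))))

sum-punchIn-≤ : ∀ {m} (f : Fin (suc m) → ℕ) i → sum (f ∘ punchIn i) ≤ sum f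
sum-punchIn-≤ f i = ≤-trans (m≤n+m _ (f i)) (≤-reflexive (≡-sym (sum-remove {i = i} f)))

-- Greedy choice: deleting the row and the column of a chosen entry costs at most 2M of the total, and
-- an (m-j)×(m-j) matrix whose total exceeds (m-j)²ρ has an entry above ρ.
heavy-transversal : ∀ {ρ M} k m (a : Fin m → Fin m → ℕ) →
  (∀ i → sum (a i) ≤ M) → (∀ j → sum (λ i → a i j) ≤ M) →
  (∀ j → j < k → j * (M + M) + (m ∸ j) * ((m ∸ j) * ρ) < sum (sum ∘ a)) →
  ∃₂ λ (f g : Fin k → Fin m) → Injective _≡_ _≡_ f × Injective _≡_ _≡_ g × (∀ t → ρ < a (f t) (g t))
heavy-transversal zero m a row col big = (λ ()) , (λ ()) , (λ {}) , (λ {}) , λ ()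
heavy-transversal {ρ} {M} (suc k) m a row col big
  with any? (λ i → any? (λ j → suc ρ ≤? a i j))
... | no light = ⊥-elim (<⇒≱ (big 0 (s≤s z≤n)) (begin
  sum (sum ∘ a)             ≤⟨ sum-mono (λ i → sum-mono (λ j → ≮⇒≥ (λ h → light (i , j , h)))) ⟩
  sum {m} (λ _ → sum {m} (λ _ → ρ)) ≡⟨ trans (sum-const m _) (cong (m *_) (sum-const m ρ)) ⟩
  m * (m * ρ) ∎))
  where open ≤-Reasoning
heavy-transversal {ρ} {M} (suc k) (suc m) a row col big | yes (i₀ , j₀ , heavy) =
  let f , g , f-inj , g-inj , ρ< = heavy-transversal k m a′ row′ col′ big′ in
  cons i₀ f , cons j₀ g , cons-inj f-inj , cons-inj g-inj , λ { zero → heavy ; (suc t) → ρ< t }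
  where
  a′ : Fin m → Fin m → ℕ
  a′ i j = a (punchIn i₀ i) (punchIn j₀ j)
  row′ : ∀ i → sum (a′ i) ≤ M
  row′ i = ≤-trans (sum-punchIn-≤ (a (punchIn i₀ i)) j₀) (row _)
  col′ : ∀ j → sum (λ i → a′ i j) ≤ M
  col′ j = ≤-trans (sum-punchIn-≤ (λ i → a i (punchIn j₀ j)) i₀) (col _)
  big′ : ∀ j → j < k → j * (M + M) + (m ∸ j) * ((m ∸ j) * ρ) < sum (sum ∘ a′)
  big′ j j<k = +-cancelˡ-< (M + M) _ _ (begin-strict
    M + M + (j * (M + M) + (m ∸ j) * ((m ∸ j) * ρ)) ≡⟨ ≡-sym (+-assoc (M + M) (j * (M + M)) _) ⟩
    suc j * (M + M) + (m ∸ j) * ((m ∸ j) * ρ) <⟨ big (suc j) (s≤s j<k) ⟩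
    sum (sum ∘ a) ≤⟨ sum-minor a i₀ j₀ ⟩
    sum (a i₀) + sum (λ i → a i j₀) + sum (sum ∘ a′) ≤⟨ +-monoˡ-≤ _ (+-mono-≤ (row i₀) (col j₀)) ⟩
    M + M + sum (sum ∘ a′) ∎)
    where open ≤-Reasoning
  cons : Fin (suc m) → (Fin k → Fin m) → Fin (suc k) → Fin (suc m)
  cons i f zero = i
  cons i f (suc t) = punchIn i (f t)
  cons-inj : ∀ {i f} → Injective _≡_ _≡_ f → Injective _≡_ _≡_ (cons i f)
  cons-inj inj {zero} {zero} _ = refl
  cons-inj inj {zero} {suc t} e = ⊥-elim (punchInᵢ≢i _ _ (≡-sym e))
  cons-inj inj {suc t} {zero} e = ⊥-elim (punchInᵢ≢i _ _ e)
  cons-inj {i} inj {suc s} {suc t} e = cong suc (inj (punchIn-injective i _ _ e))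

-- After j choices at least (3k - 2j)M of the total is left. For j = k the condition would read kM >
-- (2k)²ρ, which is where M = 4kρ + 1 comes from; smaller j leave more room.
transversal-arith : ∀ k ρ j → j < k →
  j * ((4 * k * ρ + 1) + (4 * k * ρ + 1)) + (3 * k ∸ j) * ((3 * k ∸ j) * ρ) < 3 * k * (4 * k * ρ + 1)
transversal-arith k ρ j j<k with m≤n⇒∃[o]m+o≡n j<k
... | d , refl = begin-strict
    j * ((4 * k′ * ρ + 1) + (4 * k′ * ρ + 1)) + (3 * k′ ∸ j) * ((3 * k′ ∸ j) * ρ)
  ≡⟨ cong (λ e → j * ((4 * k′ * ρ + 1) + (4 * k′ * ρ + 1)) + e * (e * ρ)) diff ⟩
    j * ((4 * k′ * ρ + 1) + (4 * k′ * ρ + 1)) + (2 * j + 3 * suc d) * ((2 * j + 3 * suc d) * ρ)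
  -- With k = j + 1 + d, the implicit argument is the difference of the two sides: a polynomial
  -- without negative coefficients, made positive by its last term.
  <⟨ m<m+n _ {4 * j * suc d * ρ + 3 * suc d * suc d * ρ + j + 3 * suc d} (≤-trans (s≤s z≤n) (m≤n+m (3 * suc d) (4 * j * suc d * ρ + 3 * suc d * suc d * ρ + j))) ⟩
    j * ((4 * k′ * ρ + 1) + (4 * k′ * ρ + 1)) + (2 * j + 3 * suc d) * ((2 * j + 3 * suc d) * ρ)
      + (4 * j * suc d * ρ + 3 * suc d * suc d * ρ + j + 3 * suc d)
  ≡⟨ ring j d ρ ⟩
    3 * k′ * (4 * k′ * ρ + 1) ∎
  where
  open ≤-Reasoning
  k′ = suc j + d
  ring : ∀ j d ρ → j * ((4 * (suc j + d) * ρ + 1) + (4 * (suc j + d) * ρ + 1)) + (2 * j + 3 * suc d) * ((2 * j + 3 * suc d) * ρ)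
      + (4 * j * suc d * ρ + 3 * suc d * suc d * ρ + j + 3 * suc d) ≡ 3 * (suc j + d) * (4 * (suc j + d) * ρ + 1)
  ring = solve-∀
  ring₂ : ∀ j d → 3 * (suc j + d) ≡ j + (2 * j + 3 * suc d)
  ring₂ = solve-∀
  diff : 3 * k′ ∸ j ≡ 2 * j + 3 * suc d
  diff = trans (cong (_∸ j) (ring₂ j d)) (m+n∸m≡n j _)

-- The left side is 36k²ρ + 9k, linear in ρ. Raising 4k²ρ to 4k²ρ² and 9k to 9k² turns it into a
-- termwise lower bound for the right side.
width-arith : ∀ k ρ → 1 ≤ k →
  3 * (3 * k * (4 * k * ρ + 1)) ≤ 20 * k * k * suc ρ * suc ρ ∸ 8 * k * k * suc ρ + 2 * suc ρ ∸ 1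
width-arith k ρ 1≤k = begin
  3 * (3 * k * (4 * k * ρ + 1)) ≡⟨ ring₁ k ρ ⟩
  32 * k * k * ρ + k * (k * (4 * ρ)) + 9 * (k * 1)
    ≤⟨ +-mono-≤ (+-monoʳ-≤ (32 * k * k * ρ) (*-monoʳ-≤ k (*-monoʳ-≤ k (*-monoʳ-≤ 4 (ρ≤ρ² ρ))))) (*-monoʳ-≤ 9 (*-monoʳ-≤ k 1≤k)) ⟩
  32 * k * k * ρ + k * (k * (4 * (ρ * ρ))) + 9 * (k * k)
    ≤⟨ m≤m+n _ (3 * k * k + 16 * k * k * ρ * ρ + 2 * ρ + 1) ⟩
  32 * k * k * ρ + k * (k * (4 * (ρ * ρ))) + 9 * (k * k) + (3 * k * k + 16 * k * k * ρ * ρ + 2 * ρ + 1)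
    ≡⟨ ring₂ k ρ ⟩
  Q + (2 * ρ + 1)
    -- Writing 20k²r² as 8k²r + Q shows that the truncated subtraction is exact.
    ≡⟨ ≡-sym (trans (cong (λ e → e + 2 * suc ρ ∸ 1) (trans (cong (_∸ 8 * k * k * suc ρ) (ring₃ k ρ)) (m+n∸m≡n (8 * k * k * suc ρ) Q))) (cong (_∸ 1) (ring₄ Q ρ))) ⟩
  20 * k * k * suc ρ * suc ρ ∸ 8 * k * k * suc ρ + 2 * suc ρ ∸ 1 ∎
  where
  open ≤-Reasoning
  Q = 12 * k * k + 32 * k * k * ρ + 20 * k * k * ρ * ρ
  ρ≤ρ² : ∀ ρ → ρ ≤ ρ * ρ
  ρ≤ρ² zero = z≤n
  ρ≤ρ² (suc ρ) = m≤m*n (suc ρ) (suc ρ)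
  ring₁ : ∀ k ρ → 3 * (3 * k * (4 * k * ρ + 1)) ≡ 32 * k * k * ρ + k * (k * (4 * ρ)) + 9 * (k * 1)
  ring₁ = solve-∀
  ring₂ : ∀ k ρ → 32 * k * k * ρ + k * (k * (4 * (ρ * ρ))) + 9 * (k * k) + (3 * k * k + 16 * k * k * ρ * ρ + 2 * ρ + 1)
    ≡ 12 * k * k + 32 * k * k * ρ + 20 * k * k * ρ * ρ + (2 * ρ + 1)
  ring₂ = solve-∀
  ring₃ : ∀ k ρ → 20 * k * k * suc ρ * suc ρ ≡ 8 * k * k * suc ρ + (12 * k * k + 32 * k * k * ρ + 20 * k * k * ρ * ρ)
  ring₃ = solve-∀
  ring₄ : ∀ q ρ → q + 2 * suc ρ ≡ 1 + (q + (2 * ρ + 1))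
  ring₄ = solve-∀

just≢nothing : {A : Set} {x : Maybe A} {y : A} → x ≡ just y → x ≢ nothing
just≢nothing refl ()

≢nothing⇒just : {A : Set} {x : Maybe A} → x ≢ nothing → ∃ λ y → x ≡ just y
≢nothing⇒just {x = just y} _ = y , refl
≢nothing⇒just {x = nothing} h = ⊥-elim (h refl)

-- The fuelled recursions on matchings and chains keep `ν ≤ fuel + ∣ p ∣` for a growing set `p`, so
-- running out of fuel means that `p` is everything.
full : {p : Subset ν} → ν ≤ ∣ p ∣ → ∀ x → x ∈ p
full {p = p} h x = subst (x ∈_) (≡-sym (∣p∣≡n⇒p≡⊤ (≤-antisym (∣p∣≤n p) h))) ∈⊤

insert : Subset ν → Fin ν → Subset ν
insert p x = p ∪ ⁅ x ⁆

∈-insert : ∀ {p : Subset ν} {x} → x ∈ insert p x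
∈-insert {p = p} {x} = q⊆p∪q p _ (x∈⁅x⁆ x)

⊆-insert : ∀ {p : Subset ν} {x} → p ⊆ insert p x
⊆-insert = p⊆p∪q _

insert⁻ : ∀ {p : Subset ν} {x y} → y ∈ insert p x → y ∈ p ⊎ y ≡ x
insert⁻ {p = p} {x} y∈ with x∈p∪q⁻ p _ y∈
... | inj₁ h = inj₁ h
... | inj₂ h = inj₂ (x∈⁅y⁆⇒x≡y x h)

∣∣<-strict : ∀ {p q : Subset ν} {x} → p ⊆ q → x ∈ q → x ∉ p → ∣ p ∣ < ∣ q ∣
∣∣<-strict p⊆q x∈q x∉p = p⊂q⇒∣p∣<∣q∣ (p⊆q , _ , x∈q , x∉p)

-- König's theorem

module Bipartite {a b : ℕ} (E : Fin a → Fin b → Set) (E? : Decidable₂ E) where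

  Matching : Set
  Matching = Fin a → Maybe (Fin b)

  record IsMatching (μ : Matching) : Set where
    field
      along : ∀ {u v} → μ u ≡ just v → E u v
      inj   : ∀ {u u′ v} → μ u ≡ just v → μ u′ ≡ just v → u ≡ u′
  open IsMatching

  _[_↦_] : Matching → Fin a → Maybe (Fin b) → Matching
  (μ [ u ↦ v ]) w with w ≟ u
  ... | yes _ = v
  ... | no _ = μ w

  ↦-same : ∀ μ u v → (μ [ u ↦ v ]) u ≡ v
  ↦-same μ u v with u ≟ u
  ... | yes _ = refl
  ... | no h = ⊥-elim (h refl)

  ↦-other : ∀ μ {u} v {w} → w ≢ u → (μ [ u ↦ v ]) w ≡ μ w
  ↦-other μ {u} v {w} w≢u with w ≟ u
  ... | yes h = ⊥-elim (w≢u h)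
  ... | no _ = refl

  Free : Matching → Fin b → Set
  Free μ v = ∀ u → μ u ≢ just v

  insert-matching : ∀ {μ u v} → IsMatching μ → E u v → Free μ v → IsMatching (μ [ u ↦ just v ])
  insert-matching {μ} {u} {v} M e free = record { along = along′ ; inj = inj′ }
    where
    along′ : ∀ {w x} → (μ [ u ↦ just v ]) w ≡ just x → E w x
    along′ {w} h with w ≟ u
    along′ refl | yes refl = e
    along′ h | no _ = along M h
    inj′ : ∀ {w w′ x} → (μ [ u ↦ just v ]) w ≡ just x → (μ [ u ↦ just v ]) w′ ≡ just x → w ≡ w′
    inj′ {w} {w′} h h′ with w ≟ u | w′ ≟ u
    inj′ h h′ | yes refl | yes refl = refl
    inj′ refl h′ | yes refl | no _ = ⊥-elim (free _ h′)
    inj′ h refl | no _ | yes refl = ⊥-elim (free _ h)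
    inj′ h h′ | no _ | no _ = inj M h h′

  delete-⊆ : ∀ μ u {w v} → (μ [ u ↦ nothing ]) w ≡ just v → μ w ≡ just v × w ≢ u
  delete-⊆ μ u {w} h with w ≟ u
  delete-⊆ μ u () | yes _
  delete-⊆ μ u h | no w≢u = h , w≢u

  delete-matching : ∀ {μ u} → IsMatching μ → IsMatching (μ [ u ↦ nothing ])
  delete-matching {μ} {u} M = record
    { along = λ h → along M (proj₁ (delete-⊆ μ u h))
    ; inj = λ h h′ → inj M (proj₁ (delete-⊆ μ u h)) (proj₁ (delete-⊆ μ u h′)) }

  NeighboursIn : Fin a → Subset b → Set
  NeighboursIn u D = ∀ v → E u v → v ∈ D

  -- By `avoids`, right vertices in `D` get no new partner. A search from the former partner of `v`,
  -- with `v` put into `D`, thus leaves `v` free for `u`.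
  record Augmentation (μ : Matching) (D : Subset b) (u : Fin a) : Set where
    field
      μ′      : Matching
      matching : IsMatching μ′
      keeps   : ∀ {w} → μ w ≢ nothing → μ′ w ≢ nothing
      matched : μ′ u ≢ nothing
      avoids  : ∀ {w v} → v ∈ D → μ′ w ≡ just v → μ w ≡ just v

  -- A failed search: the vertices added to `D` are matched, and the neighbours of their partners
  -- are in `D′` again, so alternating paths through them do not leave `D′`.
  record Obstruction (μ : Matching) (D : Subset b) (u : Fin a) : Set where
    field
      D′         : Subset b
      extends    : D ⊆ D′
      neighbours : NeighboursIn u D′
      closed     : ∀ {v} → v ∈ D′ → v ∈ D ⊎ (∃ λ w → μ w ≡ just v × NeighboursIn w D′)

  -- Depth-first search for an alternating path from u that avoids the right vertices in D.
  search : ∀ fuel (μ : Matching) (D : Subset b) u → IsMatching μ → b ≤ fuel + ∣ D ∣ →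
    Augmentation μ D u ⊎ Obstruction μ D u
  search zero μ D u M enough = inj₂ (record
    { D′ = D ; extends = id ; neighbours = λ v _ → full enough v ; closed = inj₁ })
  search (suc fuel) μ D u M enough with any? (λ v → E? u v ×-dec ¬? (v ∈? D))
  ... | no none = inj₂ (record
    { D′ = D ; extends = id
    ; neighbours = λ v e → decidable-stable (v ∈? D) (λ v∉ → none (v , e , v∉))
    ; closed = inj₁ })
  ... | yes (v , e , v∉D) with any? (λ w → ≡-dec _≟_ (μ w) (just v))
  ...   | no free = inj₁ (record
    { μ′ = μ [ u ↦ just v ]
    ; matching = insert-matching M e (λ w h → free (w , h))
    ; keeps = keeps
    ; matched = just≢nothing (↦-same μ u (just v))
    ; avoids = avoids })
    where
    keeps : ∀ {w} → μ w ≢ nothing → (μ [ u ↦ just v ]) w ≢ nothing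
    keeps {w} h with w ≟ u
    ... | yes _ = λ ()
    ... | no _ = h
    avoids : ∀ {w x} → x ∈ D → (μ [ u ↦ just v ]) w ≡ just x → μ w ≡ just x
    avoids {w} x∈ h with w ≟ u
    avoids x∈ refl | yes _ = ⊥-elim (v∉D x∈)
    avoids x∈ h | no _ = h
  ...   | yes (w , μw≡v) with search fuel (μ [ w ↦ nothing ]) (insert D v) w (delete-matching M) enough′
    where
    enough′ : b ≤ fuel + ∣ insert D v ∣
    enough′ = ≤-trans enough (≤-trans (≤-reflexive (≡-sym (+-suc fuel _)))
      (+-monoʳ-≤ fuel (∣∣<-strict ⊆-insert ∈-insert v∉D)))
  ...     | inj₁ A = inj₁ (record
    { μ′ = A.μ′ [ u ↦ just v ]
    ; matching = insert-matching A.matching e (λ x h → proj₂ (old ∈-insert h) (inj M (proj₁ (old ∈-insert h)) μw≡v))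
    ; keeps = keeps
    ; matched = just≢nothing (↦-same A.μ′ u (just v))
    ; avoids = avoids })
    where
    module A = Augmentation A
    old : ∀ {x y} → y ∈ insert D v → A.μ′ x ≡ just y → μ x ≡ just y × x ≢ w
    old y∈ h = delete-⊆ μ w (A.avoids y∈ h)
    keeps : ∀ {x} → μ x ≢ nothing → (A.μ′ [ u ↦ just v ]) x ≢ nothing
    keeps {x} h with x ≟ u
    ... | yes _ = λ ()
    ... | no _ with x ≟ w
    ...   | yes refl = A.matched
    ...   | no x≢w = A.keeps (λ h′ → h (trans (≡-sym (↦-other μ nothing x≢w)) h′))
    avoids : ∀ {x y} → y ∈ D → (A.μ′ [ u ↦ just v ]) x ≡ just y → μ x ≡ just y
    avoids {x} y∈ h with x ≟ u
    avoids y∈ refl | yes _ = ⊥-elim (v∉D y∈)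
    avoids y∈ h | no _ = proj₁ (old (⊆-insert y∈) h)
  -- The way through `v` is blocked; the search from `u` goes on with everything visited so far
  -- excluded.
  ...     | inj₂ O with search fuel μ (Obstruction.D′ O) u M enough′
    where
    enough′ : b ≤ fuel + ∣ Obstruction.D′ O ∣
    enough′ = ≤-trans enough (≤-trans (≤-reflexive (≡-sym (+-suc fuel _)))
      (+-monoʳ-≤ fuel (∣∣<-strict (Obstruction.extends O ∘ ⊆-insert) (Obstruction.extends O ∈-insert) v∉D)))
  ...       | inj₁ A = inj₁ (record
    { μ′ = A.μ′ ; matching = A.matching ; keeps = A.keeps ; matched = A.matched
    ; avoids = λ v∈ → A.avoids (Obstruction.extends O (⊆-insert v∈)) })
    where module A = Augmentation A
  ...       | inj₂ P = inj₂ (record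
    { D′ = P.D′ ; extends = P.extends ∘ O.extends ∘ ⊆-insert ; neighbours = P.neighbours ; closed = closed })
    where
    module O = Obstruction O
    module P = Obstruction P
    closed : ∀ {x} → x ∈ P.D′ → x ∈ D ⊎ (∃ λ y → μ y ≡ just x × NeighboursIn y P.D′)
    closed x∈ with P.closed x∈
    ... | inj₂ h = inj₂ h
    ... | inj₁ x∈O with O.closed x∈O
    ...   | inj₂ (y , h , ns) = inj₂ (y , proj₁ (delete-⊆ μ w h) , λ z e → P.extends (ns z e))
    ...   | inj₁ x∈ins with insert⁻ x∈ins
    ...     | inj₁ x∈D = inj₁ x∈D
    -- The partner of `v` is `w`, which was unmatched during the inner search and so has to be
    -- supplied here.
    ...     | inj₂ refl = inj₂ (w , μw≡v , λ z e → P.extends (O.neighbours z e))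

  -- `D` is the right half of a vertex cover containing exactly one end of each matching edge, hence
  -- a minimum one. The left half is implicit: the left vertices matched outside `D`. The last two
  -- fields say that all other left vertices have their neighbours in `D`.
  record König : Set where
    field
      μ        : Matching
      matching : IsMatching μ
      D        : Subset b
      D-matched : ∀ {v} → v ∈ D → ∃ λ u → μ u ≡ just v
      free-closed : ∀ {u} → μ u ≡ nothing → NeighboursIn u D
      D-closed : ∀ {u v} → μ u ≡ just v → v ∈ D → NeighboursIn u D

  private
    matched? : (μ : Matching) → Decidable (λ u → μ u ≢ nothing)
    matched? μ u = ¬? (≡-dec _≟_ (μ u) nothing)

    domain : Matching → Subset a
    domain μ = subset (matched? μ)

    Closed : Matching → Subset b → Set
    Closed μ D = ∀ {v} → v ∈ D → ∃ λ u → μ u ≡ just v × NeighboursIn u D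

    -- Lexicographic recursion: `f₁` bounds the number of unmatched left vertices, `f₂` that of
    -- right vertices outside `D`. An augmentation changes the matching for which `D` was closed, so
    -- `D` starts again at `⊥`.
    improve : ∀ f₁ f₂ μ D → IsMatching μ → Closed μ D → a ≤ f₁ + ∣ domain μ ∣ → b ≤ f₂ + ∣ D ∣ → König
    improve f₁ f₂ μ D M cl en₁ en₂
      with any? (λ u → ≡-dec _≟_ (μ u) nothing ×-dec any? (λ v → E? u v ×-dec ¬? (v ∈? D)))
    ... | no none = record
      { μ = μ ; matching = M ; D = D
      ; D-matched = λ v∈ → let u , h , _ = cl v∈ in u , h
      ; free-closed = λ {u} h v e → decidable-stable (v ∈? D) (λ v∉ → none (u , h , v , e , v∉))
      ; D-closed = λ h v∈ → let u , h′ , ns = cl v∈ in subst (λ x → NeighboursIn x D) (inj M h′ h) ns }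
    improve zero f₂ μ D M cl en₁ en₂ | yes (u , h , _) =
      ⊥-elim (∈-subset⁻ (matched? μ) (full en₁ u) h)
    improve (suc f₁) zero μ D M cl en₁ en₂ | yes (u , h , v , e , v∉) = ⊥-elim (v∉ (full en₂ v))
    improve (suc f₁) (suc f₂) μ D M cl en₁ en₂ | yes (u , h , v , e , v∉) =
      [ (λ A → improve f₁ b (Augmentation.μ′ A) ⊥ (Augmentation.matching A) (⊥-elim ∘ ∉⊥) (en₁′ A) (m≤m+n b _))
      , (λ O → improve (suc f₁) f₂ μ (Obstruction.D′ O) M (cl′ O) en₁ (en₂′ O))
      ]′ (search b μ D u M (m≤m+n b _))
      where
      en₁′ : (A : Augmentation μ D u) → a ≤ f₁ + ∣ domain (Augmentation.μ′ A) ∣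
      en₁′ A = ≤-trans en₁ (≤-trans (≤-reflexive (≡-sym (+-suc f₁ _)))
        (+-monoʳ-≤ f₁ (∣∣<-strict
          (λ x∈ → ∈-subset⁺ (matched? A.μ′) (A.keeps (∈-subset⁻ (matched? μ) x∈)))
          (∈-subset⁺ (matched? A.μ′) A.matched)
          (λ u∈ → ∈-subset⁻ (matched? μ) u∈ h))))
        where module A = Augmentation A
      cl′ : (O : Obstruction μ D u) → Closed μ (Obstruction.D′ O)
      cl′ O v∈ with Obstruction.closed O v∈
      ... | inj₂ h = h
      ... | inj₁ v∈D = let u , h , ns = cl v∈D in u , h , λ z e → Obstruction.extends O (ns z e)
      en₂′ : (O : Obstruction μ D u) → b ≤ f₂ + ∣ Obstruction.D′ O ∣
      en₂′ O = ≤-trans en₂ (≤-trans (≤-reflexive (≡-sym (+-suc f₂ _)))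
        (+-monoʳ-≤ f₂ (∣∣<-strict (Obstruction.extends O) (Obstruction.neighbours O v e) v∉)))

  abstract
    könig : König
    könig = improve a b (λ _ → nothing) ⊥ (record { along = λ () ; inj = λ () }) (⊥-elim ∘ ∉⊥) (m≤m+n a _) (m≤m+n b _)

-- Chains of a partial injection

module Chain {ν : ℕ} (f : Fin ν → Maybe (Fin ν)) where

  end : ℕ → Fin ν → Fin ν
  end zero u = u
  end (suc t) u = maybe′ (end t) u (f u)

  end-step : ∀ {t u v} → f u ≡ just v → end (suc t) u ≡ end t v
  end-step h rewrite h = refl

  end-stop : ∀ {u} t → f u ≡ nothing → end t u ≡ u
  end-stop zero h = refl
  end-stop (suc t) h rewrite h = refl

  end-mono : ∀ {s t u} → s ≤ t → f (end s u) ≡ nothing → end t u ≡ end s u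
  end-mono {t = t} z≤n h = end-stop t h
  end-mono {suc s} {suc t} {u} (s≤s s≤t) h with f u
  ... | just v = end-mono s≤t h
  ... | nothing = refl

  end-invariant : (P : Fin ν → Set) → (∀ {u v} → P u → f u ≡ just v → P v) → ∀ t {u} → P u → P (end t u)
  end-invariant P next zero p = p
  end-invariant P next (suc t) {u} p with f u in eq
  ... | just v = end-invariant P next t (next p eq)
  ... | nothing = p

  Source : Fin ν → Set
  Source v = ∀ u → f u ≢ just v

  data Path (u : Fin ν) : Fin ν → Set where
    []   : Path u u
    _▷_ : ∀ {v w} → Path u v → f v ≡ just w → Path u w

  _◁_ : ∀ {u v w} → f u ≡ just v → Path v w → Path u w
  h ◁ [] = [] ▷ h
  h ◁ (p ▷ h′) = (h ◁ p) ▷ h′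

  end-path : ∀ t u → Path u (end t u)
  end-path zero u = []
  end-path (suc t) u with f u in eq
  ... | just v = eq ◁ end-path t v
  ... | nothing = []

  module Injective (f-inj : ∀ {u u′ v} → f u ≡ just v → f u′ ≡ just v → u ≡ u′) where

    -- Both paths are retraced from their common end, where `f-inj` makes the last arrows agree;
    -- whichever is used up first has reached a source, so the other stops there too. This is why
    -- `Path` grows at its far end.
    sources-agree : ∀ {u u′ v} → Source u → Source u′ → Path u v → Path u′ v → u ≡ u′
    sources-agree s s′ [] [] = refl
    sources-agree s s′ [] (p ▷ h) = ⊥-elim (s _ h)
    sources-agree s s′ (p ▷ h) [] = ⊥-elim (s′ _ h)
    sources-agree s s′ (p ▷ h) (p′ ▷ h′) with f-inj h h′
    ... | refl = sources-agree s s′ p p′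

    end-injective : ∀ t {u u′} → Source u → Source u′ → end t u ≡ end t u′ → u ≡ u′
    end-injective t {u} {u′} s s′ e = sources-agree s s′ (end-path t u) (subst (Path u′) (≡-sym e) (end-path t u′))

    -- V collects the vertices already visited; it is closed under predecessors, so the chain cannot re-enter it.
    private
      escape : ∀ t (V : Subset ν) w → ν ≤ t + ∣ V ∣ → w ∉ V → (∀ {u} → f u ≡ just w → u ∈ V) →
        (∀ {u v} → v ∈ V → f u ≡ just v → u ∈ V) → f (end t w) ≡ nothing
      escape zero V w en w∉ back closed = ⊥-elim (w∉ (full en w))
      escape (suc t) V w en w∉ back closed with f w in eq
      ... | nothing = eq
      ... | just v = escape t (insert V w) v en′ v∉ (λ h → subst (_∈ insert V w) (f-inj eq h) ∈-insert) closed′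
        where
        en′ : ν ≤ t + ∣ insert V w ∣
        en′ = ≤-trans en (≤-trans (≤-reflexive (≡-sym (+-suc t _))) (+-monoʳ-≤ t (∣∣<-strict ⊆-insert ∈-insert w∉)))
        v∉ : v ∉ insert V w
        v∉ v∈ with insert⁻ v∈
        ... | inj₁ v∈V = w∉ (closed v∈V eq)
        ... | inj₂ refl = w∉ (back eq)
        closed′ : ∀ {x y} → y ∈ insert V w → f x ≡ just y → x ∈ insert V w
        closed′ y∈ h with insert⁻ y∈
        ... | inj₁ y∈V = ⊆-insert (closed y∈V h)
        ... | inj₂ refl = ⊆-insert (back h)

    end-maximal : ∀ {u} → Source u → f (end ν u) ≡ nothing
    end-maximal {u} s = escape ν ⊥ u (m≤m+n ν _) ∉⊥ (λ h → ⊥-elim (s _ h)) (λ v∈ → ⊥-elim (∉⊥ v∈))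

-- Tree decompositions

does⇒ : {P : Set} (p? : Dec P) → does p? ≡ true → P
does⇒ (yes p) _ = p

walk-map : ∀ {G H : Graph} {P : Fin (n G) → Set} {Q : Fin (n H) → Set} (φ : Fin (n G) → Fin (n H)) →
  (∀ {x y} → Edge G x y → Edge H (φ x) (φ y)) → (∀ {x} → P x → Q (φ x)) →
  ∀ {x y} → WalkIn G P x y → WalkIn H Q (φ x) (φ y)
walk-map φ e i (here p) = here (i p)
walk-map φ e i (step p h w) = step (i p) (e h) (walk-map φ e i w)

walk-++ : ∀ {G P x y z} → WalkIn G P x y → WalkIn G P y z → WalkIn G P x z
walk-++ (here _) w = w
walk-++ (step p h v) w = step p h (walk-++ v w)

edge-sym : ∀ {G x y} → Edge G x y → Edge G y x
edge-sym {G} {x} {y} h = trans (sym G y x) h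

walk-reverse : ∀ {G P x y} → WalkIn G P x y → WalkIn G P y x
walk-reverse (here p) = here p
walk-reverse {G} (step p h w) = walk-++ (walk-reverse w) (step (walk-start w) (edge-sym {G} h) (here p))
  where
  walk-start : ∀ {P x y} → WalkIn G P x y → P x
  walk-start (here p) = p
  walk-start (step p _ _) = p

addLeaf : (T : Graph) → Fin (n T) → Graph
addLeaf T p = record { n = suc (n T) ; adj = A ; sym = S ; irrefl = I }
  where
  A : Fin (suc (n T)) → Fin (suc (n T)) → Bool
  A zero zero = false
  A zero (suc j) = does (p ≟ j)
  A (suc i) zero = does (p ≟ i)
  A (suc i) (suc j) = adj T i j
  S : ∀ x y → A x y ≡ A y x
  S zero zero = refl
  S zero (suc j) = refl
  S (suc i) zero = refl
  S (suc i) (suc j) = sym T i j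
  I : ∀ x → A x x ≡ false
  I zero = refl
  I (suc i) = irrefl T i

module _ {T : Graph} {p : Fin (n T)} where

  leaf-edge : Edge (addLeaf T p) zero (suc p)
  leaf-edge = dec-true (p ≟ p) refl

  leaf-neighbour : ∀ {x} → Edge (addLeaf T p) zero x → x ≡ suc p
  leaf-neighbour {suc x} h = cong suc (≡-sym (does⇒ (p ≟ x) h))

  unleaf : ∀ {m} (c : Fin m → Fin (suc (n T))) → (∀ i → c i ≢ zero) → ∃ λ (d : Fin m → Fin (n T)) → ∀ i → c i ≡ suc (d i)
  unleaf c h = (λ i → proj₁ (pred i)) , (λ i → proj₂ (pred i))
    where
    pred : ∀ i → ∃ λ j → c i ≡ suc j
    pred i with c i in eq
    ... | zero = ⊥-elim (h i eq)
    ... | suc j = j , refl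

  addLeaf-acyclic : Acyclic T → Acyclic (addLeaf T p)
  addLeaf-acyclic acyc C with any? (λ i → Cycle.c C i ≟ zero)
  ... | no h = acyc (record
      { m = Cycle.m C ; c = d
      ; inj = λ {i} {j} e → Cycle.inj C (trans (eq i) (trans (cong suc e) (≡-sym (eq j))))
      ; edges = λ i → lower (eq _) (eq _) (Cycle.edges C i)
      ; closes = lower (eq _) (eq _) (Cycle.closes C) })
    where
    d = proj₁ (unleaf (Cycle.c C) (λ i e → h (i , e)))
    eq = proj₂ (unleaf (Cycle.c C) (λ i e → h (i , e)))
    lower : ∀ {x y i j} → x ≡ suc i → y ≡ suc j → Edge (addLeaf T p) x y → Edge T i j
    lower refl refl e = e
  ... | yes (i , ci≡0) = two-neighbours (split i)
    where
    open Cycle C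
    G′ = addLeaf T p
    -- A leaf of the tree on a cycle would have its two distinct cyclic neighbours equal to its parent.
    clash : ∀ {j k} → j ≢ k → Edge G′ (c i) (c j) → Edge G′ (c i) (c k) → Empty.⊥
    clash j≢k e e′ = j≢k (inj (trans (nb e) (≡-sym (nb e′))))
      where
      nb : ∀ {x} → Edge G′ (c i) x → x ≡ suc p
      nb {x} e = leaf-neighbour (subst (λ y → Edge G′ y x) ci≡0 e)
    data Split : Fin (suc (suc (suc m))) → Set where
      first  : Split zero
      last   : Split (fromℕ (suc (suc m)))
      middle : ∀ (j : Fin (suc m)) → Split (suc (inject₁ j))
    split : ∀ i → Split i
    split zero = first
    split (suc i) = go i
      where
      top : ∀ {l} (j : Fin (suc l)) → j ≡ fromℕ l ⊎ ∃ λ k → j ≡ inject₁ k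
      top {zero} zero = inj₁ refl
      top {suc l} zero = inj₂ (zero , refl)
      top {suc l} (suc j) with top j
      ... | inj₁ e = inj₁ (cong suc e)
      ... | inj₂ (k , e) = inj₂ (suc k , cong suc e)
      go : ∀ i → Split (suc i)
      go i with top i
      ... | inj₁ refl = last
      ... | inj₂ (j , refl) = middle j
    inject₁²≢suc² : ∀ {l} (j : Fin l) → inject₁ (inject₁ j) ≢ suc (suc j)
    inject₁²≢suc² (suc j) e = inject₁²≢suc² j (suc-injective e)
    flip : ∀ {j k} → Edge G′ (c j) (c k) → Edge G′ (c k) (c j)
    flip {j} {k} = edge-sym {G′} {c j} {c k}
    two-neighbours : Split i → Empty.⊥
    two-neighbours first = clash {j = suc zero} {fromℕ (suc (suc m))} (λ ()) (edges zero) (flip {fromℕ _} {zero} closes)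
    two-neighbours last = clash {j = zero} {inject₁ (fromℕ (suc m))} (λ ()) closes (flip {inject₁ (fromℕ _)} {fromℕ _} (edges (fromℕ (suc m))))
    two-neighbours (middle j) = clash (inject₁²≢suc² j) (flip {inject₁ (inject₁ j)} {suc (inject₁ j)} (edges (inject₁ j))) (edges (suc j))

  addLeaf-isTree : IsTree T → IsTree (addLeaf T p)
  addLeaf-isTree t = record { nonempty = zero ; connected = conn ; acyclic = addLeaf-acyclic (IsTree.acyclic t) }
    where
    up : ∀ i j → WalkIn (addLeaf T p) Everything (suc i) (suc j)
    up i j = walk-map suc id id (IsTree.connected t i j tt tt)
    conn : Connected (addLeaf T p)
    conn zero zero _ _ = here tt
    conn zero (suc j) _ _ = step tt leaf-edge (up p j)
    conn (suc i) zero _ _ = walk-reverse (step tt leaf-edge (up p i))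
    conn (suc i) (suc j) _ _ = up i j

-- A tree decomposition of the part C of G, to be hung below a bag containing B.
data Elim (G : Graph) (w : ℕ) (B C : Subset (n G)) : Set where
  done  : Empty C → Elim G w B C
  split : (B′ C₁ C₂ : Subset (n G)) → ∣ B′ ∣ ≤ w →
    (∀ {x} → x ∈ B′ → x ∈ C ⊎ x ∈ B) →
    (∀ {x y} → x ∈ C → y ∉ C → Edge G x y → y ∈ B′) →
    (∀ {x} → x ∈ C → x ∈ B′ ⊎ x ∈ C₁ ⊎ x ∈ C₂) →
    C₁ ⊆ C → C₂ ⊆ C → (∀ {x} → x ∈ C₁ → x ∉ B′) → (∀ {x} → x ∈ C₂ → x ∉ B′) → (∀ {x} → x ∈ C₁ → x ∉ C₂) →
    Elim G w B′ C₁ → Elim G w B′ C₂ → Elim G w B C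

-- A tree decomposition of the subgraph induced on the vertices covered so far.
record Partial (G : Graph) (w : ℕ) : Set where
  field
    T        : Graph
    isTree   : IsTree T
    bag      : Fin (n T) → Subset (n G)
    size     : ∀ t → ∣ bag t ∣ ≤ w
  Covered : Fin (n G) → Set
  Covered v = ∃ λ t → v ∈ bag t
  field
    edgeIn   : ∀ {u v} → Covered u → Covered v → Edge G u v → ∃ λ t → (u ∈ bag t) × (v ∈ bag t)
    coherent : ∀ v → ConnectedIn T (λ t → v ∈ bag t)

module _ {G : Graph} {w : ℕ} where
  open Partial

  -- Two parts are hung below the same bag one after the other: `bags` preserves that bag, and
  -- `only` keeps the second part uncovered while the first is added.
  record _⊑[_]_ (P : Partial G w) (C : Subset (n G)) (Q : Partial G w) : Set where
    field
      embed  : Fin (n (T P)) → Fin (n (T Q))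
      bags   : ∀ t → bag Q (embed t) ≡ bag P t
      gained : ∀ {x} → x ∈ C → Covered Q x
      only   : ∀ {x} → Covered Q x → Covered P x ⊎ x ∈ C

    still : ∀ {x} → Covered P x → Covered Q x
    still {x} (t , h) = embed t , subst (x ∈_) (≡-sym (bags t)) h
  open _⊑[_]_

  attach : (P : Partial G w) (t : Fin (n (T P))) (B : Subset (n G)) → ∣ B ∣ ≤ w →
    (∀ {x} → x ∈ B → Covered P x → x ∈ bag P t) →
    (∀ {x y} → x ∈ B → Covered P y → Edge G x y → (∃ λ s → x ∈ bag P s × y ∈ bag P s) ⊎ y ∈ B) → Partial G w
  attach P t B B≤ old edge = record
    { T = addLeaf (T P) t ; isTree = addLeaf-isTree (isTree P) ; bag = bag′
    ; size = λ { zero → B≤ ; (suc s) → size P s } ; edgeIn = edgeIn′ ; coherent = coherent′ }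
    where
    bag′ : Fin (suc (n (T P))) → Subset (n G)
    bag′ zero = B
    bag′ (suc s) = bag P s
    below : ∀ {u v} → (∃ λ s → u ∈ bag P s × v ∈ bag P s) → ∃ λ s → u ∈ bag′ s × v ∈ bag′ s
    below (s , h) = suc s , h
    edgeIn′ : ∀ {u v} → (∃ λ s → u ∈ bag′ s) → (∃ λ s → v ∈ bag′ s) → Edge G u v → ∃ λ s → u ∈ bag′ s × v ∈ bag′ s
    edgeIn′ (zero , a) (zero , b) e = zero , a , b
    edgeIn′ (suc s , a) (suc s′ , b) e = below (edgeIn P (s , a) (s′ , b) e)
    edgeIn′ (zero , a) (suc s , b) e with edge a (s , b) e
    ... | inj₁ h = below h
    ... | inj₂ b′ = zero , a , b′
    edgeIn′ {u} {v} (suc s , a) (zero , b) e with edge b (s , a) (edge-sym {G} {u} {v} e)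
    ... | inj₁ (s′ , h , h′) = suc s′ , h′ , h
    ... | inj₂ a′ = zero , a′ , b
    up : ∀ v {x y} → WalkIn (T P) (λ s → v ∈ bag P s) x y → WalkIn (addLeaf (T P) t) (λ s → v ∈ bag′ s) (suc x) (suc y)
    up v = walk-map suc id id
    down : ∀ v {j} → v ∈ B → v ∈ bag P j → WalkIn (addLeaf (T P) t) (λ s → v ∈ bag′ s) zero (suc j)
    down v {j} a b = step a (leaf-edge {T P} {t}) (up v (coherent P v t j (old a (j , b)) b))
    coherent′ : ∀ v → ConnectedIn (addLeaf (T P) t) (λ s → v ∈ bag′ s)
    coherent′ v zero zero a b = here a
    coherent′ v zero (suc j) a b = down v a b
    coherent′ v (suc i) zero a b = walk-reverse (down v b a)
    coherent′ v (suc i) (suc j) a b = up v (coherent P v i j a b)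

  hang : ∀ {B C} → Elim G w B C → (P : Partial G w) (t : Fin (n (T P))) → B ⊆ bag P t →
    (∀ {x} → x ∈ C → ¬ Covered P x) → ∃ λ Q → P ⊑[ C ] Q
  hang (done none) P t B⊆ fresh = P , record
    { embed = id ; bags = λ _ → refl ; gained = λ x∈ → ⊥-elim (none (_ , x∈)) ; only = inj₁ }
  hang {B} {C} (split B′ C₁ C₂ B′≤ from bdry cov C₁⊆ C₂⊆ C₁#B′ C₂#B′ C₁#C₂ e₁ e₂) P t B⊆ fresh =
    let P₂ , i₁ = hang e₁ P₁ zero id fresh₁
        P₃ , i₂ = hang e₂ P₂ (embed i₁ zero) (λ {x} h → subst (x ∈_) (≡-sym (bags i₁ zero)) h)
                    (λ x∈ c → [ fresh₂ x∈ , (λ x∈₁ → C₁#C₂ x∈₁ x∈) ]′ (only i₁ c))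
    in P₃ , record
      { embed = embed i₂ ∘ embed i₁ ∘ suc
      ; bags = λ s → trans (bags i₂ _) (bags i₁ _)
      ; gained = λ x∈ → [ (λ h → still i₂ (still i₁ (zero , h))) , [ still i₂ ∘ gained i₁ , gained i₂ ]′ ]′ (cov x∈)
      ; only = λ c → [ (λ c₂ → [ only₁ , inj₂ ∘ C₁⊆ ]′ (only i₁ c₂)) , inj₂ ∘ C₂⊆ ]′ (only i₂ c) }
    where
    old : ∀ {x} → x ∈ B′ → Covered P x → x ∈ bag P t
    old x∈ c = [ (λ x∈C → ⊥-elim (fresh x∈C c)) , B⊆ ]′ (from x∈)
    edge : ∀ {x y} → x ∈ B′ → Covered P y → Edge G x y → (∃ λ s → x ∈ bag P s × y ∈ bag P s) ⊎ y ∈ B′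
    edge x∈ c e with from x∈
    -- `y` is covered and so outside `C`; as a neighbour of `C` it is in the new bag.
    ... | inj₁ x∈C = inj₂ (bdry x∈C (λ y∈C → fresh y∈C c) e)
    ... | inj₂ x∈B = inj₁ (edgeIn P (t , B⊆ x∈B) c e)
    P₁ : Partial G w
    P₁ = attach P t B′ B′≤ old edge
    only₁ : ∀ {x} → Covered P₁ x → Covered P x ⊎ x ∈ C
    only₁ (zero , h) = [ inj₂ , (λ x∈B → inj₁ (t , B⊆ x∈B)) ]′ (from h)
    only₁ (suc s , h) = inj₁ (s , h)
    fresh₁ : ∀ {x} → x ∈ C₁ → ¬ Covered P₁ x
    fresh₁ x∈ (zero , h) = C₁#B′ x∈ h
    fresh₁ x∈ (suc s , h) = fresh (C₁⊆ x∈) (s , h)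
    fresh₂ : ∀ {x} → x ∈ C₂ → ¬ Covered P₁ x
    fresh₂ x∈ (zero , h) = C₂#B′ x∈ h
    fresh₂ x∈ (suc s , h) = fresh (C₂⊆ x∈) (s , h)

point : Graph
point = record { n = 1 ; adj = λ _ _ → false ; sym = λ _ _ → refl ; irrefl = λ _ → refl }

point-isTree : IsTree point
point-isTree = record
  { nonempty = zero
  ; connected = λ { zero zero _ _ → here tt }
  ; acyclic = λ C → contradiction (Cycle.closes C) λ () }

⊔-bound : ∀ {m N} (f : Fin m → ℕ) → (∀ i → f i ≤ N) → foldr (λ _ → ℕ) _⊔_ 0 (tabulate f) ≤ N
⊔-bound {zero} f h = z≤n
⊔-bound {suc m} f h = ⊔-lub (h zero) (⊔-bound (f ∘ suc) (h ∘ suc))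

elim-treewidth : ∀ {G w N} → Elim G w ⊥ ⊤ → w ≤ N → 1 ≤ N → TreewidthLessThan G N
elim-treewidth {G} {w} {N} e w≤N 1≤N =
  let Q , i = hang e start zero id (λ _ (_ , h) → ∉⊥ h)
      open Partial Q
  in record
    { T = T ; isTree = isTree ; bag = bag ; covers = λ v → _⊑[_]_.gained i ∈⊤
    ; edgeIn = λ u v h → edgeIn (_⊑[_]_.gained i ∈⊤) (_⊑[_]_.gained i ∈⊤) h
    ; coherent = coherent }
  , bound 1≤N (⊔-bound (λ t → ∣ bag t ∣) (λ t → ≤-trans (size t) w≤N))
  where
  start : Partial G w
  start = record
    { T = point ; isTree = point-isTree ; bag = λ _ → ⊥ ; size = λ _ → ≤-trans (≤-reflexive (∣⊥∣≡0 (n G))) z≤n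
    ; edgeIn = λ (_ , h) → ⊥-elim (∉⊥ h) ; coherent = λ v x y h → ⊥-elim (∉⊥ h) }
  bound : ∀ {a b} → 1 ≤ b → a ≤ b → a ∸ 1 < b
  -- `width` subtracts 1 with truncation: if all bags are empty the width is still 0, which is below
  -- `b` because `b` is positive.
  bound {zero} 1≤b _ = 1≤b
  bound {suc a} _ a≤b = a≤b

-- Connected colour classes around a part of the graph

module Colouring (G : Graph) (m M : ℕ) where

  V : Set
  V = Fin (n G)

  Colour : Set
  Colour = Bool × Fin m

  _≟ᶜ_ : (c d : Maybe Colour) → Dec (c ≡ d)
  _≟ᶜ_ = ≡-dec (Product.≡-dec Bool._≟_ _≟_)

  edge? : ∀ x y → Dec (Edge G x y)
  edge? x y = adj G x y Bool.≟ true

  InBoundary : Subset (n G) → V → Set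
  InBoundary C v = v ∉ C × ∃ λ c → c ∈ C × Edge G c v

  abstract
    inBoundary? : ∀ C → Decidable (InBoundary C)
    inBoundary? C v = ¬? (v ∈? C) ×-dec any? (λ c → (c ∈? C) ×-dec edge? c v)

  inBoundary-remove : ∀ {C v w} → w ≢ v → InBoundary (C - v) w → InBoundary C w
  inBoundary-remove w≢v (w∉ , c , c∈ , e) = (λ w∈C → w∉ (x∈p∧x≢y⇒x∈p-y w∈C w≢v)) , c , remove-⊆ c∈ , e

  boundary : Subset (n G) → Subset (n G)
  boundary C = subset (inBoundary? C)

  abstract
    terminal? : ∀ C (col : V → Maybe Colour) i → Decidable (λ v → InBoundary C v × col v ≡ just i)
    terminal? C col i v = inBoundary? C v ×-dec (col v ≟ᶜ just i)

  terminals : Subset (n G) → (V → Maybe Colour) → Colour → Subset (n G)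
  terminals C col i = subset (terminal? C col i)

  -- A single partial function makes the classes disjoint. Vertices outside `C` may be uncoloured
  -- too, and a class may be empty or have no terminals.
  record State (C : Subset (n G)) (col : V → Maybe Colour) : Set where
    field
      connected : ∀ i → ConnectedIn G (λ v → col v ≡ just i)
      off       : ∀ {v} → v ∈ C → col v ≡ nothing
      coloured  : ∀ {v} → InBoundary C v → ∃ λ i → col v ≡ just i
      load      : ∀ i → ∣ terminals C col i ∣ ≤ M

    coloured⇒∉ : ∀ {v i} → col v ≡ just i → v ∉ C
    coloured⇒∉ h v∈ = just≢nothing h (off v∈)

  module Sides {C : Subset (n G)} {col : V → Maybe Colour} (st : State C col) where
    open State st

    InSide : Bool → V → Set
    InSide s v = InBoundary C v × ∃ λ i → col v ≡ just (s , i)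

    abstract
      inSide? : ∀ s → Decidable (InSide s)
      inSide? s v = inBoundary? C v ×-dec any? (λ i → col v ≟ᶜ just (s , i))

    side : Bool → Subset (n G)
    side s = subset (inSide? s)

    side-≤ : ∀ s → ∣ side s ∣ ≤ m * M
    side-≤ s = ≤-trans (card-cover (side s) (λ i → terminals C col (s , i))
        (λ x∈ → let b , i , h = ∈-subset⁻ (inSide? s) x∈ in i , ∈-subset⁺ (terminal? C col (s , i)) (b , h)))
      (≤-trans (sum-mono (λ i → load (s , i))) (≤-reflexive (sum-const m M)))

    boundary-≤ : ∣ boundary C ∣ ≤ 2 * (m * M)
    boundary-≤ = begin
      ∣ boundary C ∣                       ≤⟨ p⊆q⇒∣p∣≤∣q∣ coloured⊆ ⟩
      ∣ side false ∪ side true ∣           ≤⟨ ∣∪∣≤ (side false) (side true) ⟩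
      ∣ side false ∣ + ∣ side true ∣       ≤⟨ +-mono-≤ (side-≤ false) (side-≤ true) ⟩
      m * M + m * M                        ≡⟨ cong (m * M +_) (≡-sym (+-identityʳ (m * M))) ⟩
      2 * (m * M)                          ∎
      where
      open ≤-Reasoning
      coloured⊆ : boundary C ⊆ side false ∪ side true
      coloured⊆ x∈ with ∈-subset⁻ (inBoundary? C) x∈
      ... | b with coloured b
      ...   | (false , i) , h = p⊆p∪q _ (∈-subset⁺ (inSide? false) (b , i , h))
      ...   | (true , i) , h = q⊆p∪q (side false) _ (∈-subset⁺ (inSide? true) (b , i , h))

  -- Every vertex takes the colour of the vertex where its chain under `f` ends. As `f` is undefined
  -- outside `C`, the old classes keep their vertices and are only prolonged into `C`.
  module Recolour {C col} (st : State C col) (f : V → Maybe V)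
    (dom : ∀ {u v} → f u ≡ just v → u ∈ C) (adjacent : ∀ {u v} → f u ≡ just v → u ≡ v ⊎ Edge G u v) where
    open State st
    open Chain f public

    recoloured : V → Maybe Colour
    recoloured v = col (end (n G) v)

    stop : ∀ {v} → v ∉ C → f v ≡ nothing
    stop {v} v∉ with f v in eq
    ... | just w = ⊥-elim (v∉ (dom eq))
    ... | nothing = refl

    recoloured-off : ∀ {v} → f v ≡ nothing → recoloured v ≡ col v
    recoloured-off h = cong col (end-stop (n G) h)

    recoloured-old : ∀ {v i} → col v ≡ just i → recoloured v ≡ just i
    recoloured-old h = trans (recoloured-off (stop (coloured⇒∉ h))) h

    -- A coloured end lies outside `C`, so the chain has stopped there; all vertices on it share
    -- this end, and the walk stays within one class.
    toEnd : ∀ {i} t u → t ≤ n G → col (end t u) ≡ just i → WalkIn G (λ v → recoloured v ≡ just i) u (end t u)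
    toEnd zero u t≤ h = here (recoloured-old h)
    toEnd (suc t) u t≤ h with f u in eq
    ... | nothing = here (recoloured-old h)
    ... | just v with adjacent eq
    ...   | inj₁ refl = toEnd t u (≤-trans (n≤1+n t) t≤) h
    ...   | inj₂ e = step (trans (cong col same) h) e (toEnd t v (≤-trans (n≤1+n t) t≤) h)
      where
      same : end (n G) u ≡ end t v
      same = trans (end-mono t≤ (subst (λ x → f x ≡ nothing) (≡-sym (end-step {t} eq)) (stop (coloured⇒∉ h)))) (end-step {t} eq)

    recoloured-connected : ∀ i → ConnectedIn G (λ v → recoloured v ≡ just i)
    recoloured-connected i x y hx hy =
      walk-++ (toEnd (n G) x ≤-refl hx)
      (walk-++ (walk-map id id recoloured-old (connected i _ _ hx hy))
      (walk-reverse (toEnd (n G) y ≤-refl hy)))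

    module _ (f-inj : ∀ {u u′ v} → f u ≡ just v → f u′ ≡ just v → u ≡ u′) where
      open Injective f-inj

      -- Distinct sources have distinct ends, so `end` injects the new terminals of a class into its
      -- old ones and the load is preserved. The source condition concerns vertices of N(C) as well:
      -- one at which a chain arrives would otherwise be counted together with the start of that
      -- chain.
      reroute : ∀ {C′} → C′ ⊆ C → (∀ {v} → v ∈ C′ → f v ≡ nothing) →
        (∀ {v} → InBoundary C′ v → Source v) →
        (∀ {v} → v ∈ C → InBoundary C′ v → f (end (n G) v) ≡ nothing → InBoundary C (end (n G) v)) →
        State C′ recoloured
      reroute {C′} C′⊆ idle source land = record
        { connected = recoloured-connected
        ; off = λ v∈ → trans (recoloured-off (idle v∈)) (off (C′⊆ v∈))
        ; coloured = λ v∈ → coloured (lands v∈)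
        ; load = λ i → ≤-trans
            (card-injection (terminals C′ recoloured i) (terminals C col i) (end (n G))
              (λ x∈ → let b , h = ∈-subset⁻ (terminal? C′ recoloured i) x∈ in
                ∈-subset⁺ (terminal? C col i) (lands b , h))
              (λ x∈ y∈ e → end-injective (n G)
                (source (proj₁ (∈-subset⁻ (terminal? C′ recoloured i) x∈)))
                (source (proj₁ (∈-subset⁻ (terminal? C′ recoloured i) y∈))) e))
            (load i) }
        where
        lands : ∀ {v} → InBoundary C′ v → InBoundary C (end (n G) v)
        lands {v} b@(_ , c , c∈ , e) with v ∈? C
        ... | yes v∈ = land v∈ b (end-maximal (source b))
        ... | no v∉ = subst (InBoundary C) (≡-sym (end-stop (n G) (stop v∉))) (v∉ , c , C′⊆ c∈ , e)

  -- A class without terminals is useless; it is discarded and restarted at v.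
  restart : ∀ {C col v i} → State C col → v ∈ C → Empty (terminals C col i) → 1 ≤ M → ∃ (State (C - v))
  restart {C} {col} {v} {i} st v∈C none 1≤M = col′ , record
    { connected = connected′ ; off = off′ ; coloured = coloured′ ; load = load′ }
    where
    open State st
    C′ : Subset (n G)
    C′ = C - v
    col′ : V → Maybe Colour
    col′ w with w ≟ v | col w ≟ᶜ just i
    ... | yes _ | _ = just i
    ... | no _ | yes _ = nothing
    ... | no _ | no _ = col w
    new : ∀ {w} → col′ w ≡ just i → w ≡ v
    new {w} h with w ≟ v | col w ≟ᶜ just i
    new h | yes e | _ = e
    new () | no _ | yes _
    new h | no _ | no h′ = ⊥-elim (h′ h)
    old : ∀ {w j} → j ≢ i → col′ w ≡ just j → col w ≡ just j
    old {w} j≢i h with w ≟ v | col w ≟ᶜ just i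
    old j≢i refl | yes _ | _ = ⊥-elim (j≢i refl)
    old j≢i () | no _ | yes _
    old j≢i h | no _ | no _ = h
    keep : ∀ {w j} → j ≢ i → col w ≡ just j → col′ w ≡ just j
    keep {w} j≢i h with w ≟ v | col w ≟ᶜ just i
    keep j≢i h | yes refl | _ = ⊥-elim (coloured⇒∉ h v∈C)
    keep j≢i h | no _ | yes h′ = ⊥-elim (j≢i (just-injective (trans (≡-sym h) h′)))
    keep j≢i h | no _ | no _ = h
    at-v : col′ v ≡ just i
    at-v with v ≟ v | col v ≟ᶜ just i
    ... | yes _ | _ = refl
    ... | no h | _ = ⊥-elim (h refl)
    connected′ : ∀ j → ConnectedIn G (λ w → col′ w ≡ just j)
    connected′ j x y hx hy with Product.≡-dec Bool._≟_ _≟_ j i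
    ... | yes refl = subst (WalkIn G _ x) (trans (new hx) (≡-sym (new hy))) (here hx)
    ... | no j≢i = walk-map id id (keep j≢i) (connected j x y (old j≢i hx) (old j≢i hy))
    off′ : ∀ {w} → w ∈ C′ → col′ w ≡ nothing
    off′ {w} w∈ with w ≟ v | col w ≟ᶜ just i
    ... | yes refl | _ = ⊥-elim (∉-remove w∈)
    ... | no _ | yes _ = refl
    ... | no _ | no _ = off (remove-⊆ w∈)
    coloured′ : ∀ {w} → InBoundary C′ w → ∃ λ j → col′ w ≡ just j
    coloured′ {w} b = go (w ≟ v)
      where
      go : Dec (w ≡ v) → ∃ λ j → col′ w ≡ just j
      go (yes refl) = i , at-v
      go (no w≢v) = let j , h = coloured (inBoundary-remove w≢v b) in j , keep (λ { refl → none (w , ∈-subset⁺ (terminal? C col i) (inBoundary-remove w≢v b , h)) }) h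
    load′ : ∀ j → ∣ terminals C′ col′ j ∣ ≤ M
    load′ j with Product.≡-dec Bool._≟_ _≟_ j i
    ... | yes refl = ≤-trans (p⊆q⇒∣p∣≤∣q∣ (λ x∈ →
            subst (_∈ ⁅ v ⁆) (≡-sym (new (proj₂ (∈-subset⁻ (terminal? C′ col′ i) x∈)))) (x∈⁅x⁆ v)))
          (≤-trans (≤-reflexive (∣⁅x⁆∣≡1 v)) 1≤M)
    ... | no j≢i = ≤-trans (p⊆q⇒∣p∣≤∣q∣ (λ {x} x∈ →
            let b , h = ∈-subset⁻ (terminal? C′ col′ j) x∈ in
            ∈-subset⁺ (terminal? C col j) (inBoundary-remove (λ { refl → j≢i (just-injective (trans (≡-sym h) at-v)) }) b , old j≢i h)))
          (load j)

  extend : ∀ {C col v s i} → State C col → v ∈ C → col s ≡ just i → Edge G v s → ∣ terminals C col i ∣ < M →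
    ∃ (State (C - v))
  extend {C} {col} {v} {s} {i} st v∈C s-i v-s light = col′ , record
    { connected = connected′ ; off = off′ ; coloured = coloured′ ; load = load′ }
    where
    open State st
    C′ : Subset (n G)
    C′ = C - v
    col′ : V → Maybe Colour
    col′ w with w ≟ v
    ... | yes _ = just i
    ... | no _ = col w
    old : ∀ {w} → w ≢ v → col′ w ≡ col w
    old {w} w≢v with w ≟ v
    ... | yes e = ⊥-elim (w≢v e)
    ... | no _ = refl
    at-v : col′ v ≡ just i
    at-v with v ≟ v
    ... | yes _ = refl
    ... | no h = ⊥-elim (h refl)
    keep : ∀ {w j} → col w ≡ just j → col′ w ≡ just j
    keep h = trans (old (λ { refl → coloured⇒∉ h v∈C })) h
    toOld : ∀ {x j} → col′ x ≡ just j → ∃ λ y → col y ≡ just j × WalkIn G (λ w → col′ w ≡ just j) x y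
    toOld {x} hx with x ≟ v
    ... | no _ = x , hx , here (keep hx)
    toOld refl | yes refl = s , s-i , step at-v v-s (here (keep s-i))
    connected′ : ∀ j → ConnectedIn G (λ w → col′ w ≡ just j)
    connected′ j x y hx hy with toOld hx | toOld hy
    ... | x′ , hx′ , wx | y′ , hy′ , wy = walk-++ wx (walk-++ (walk-map id id keep (connected j x′ y′ hx′ hy′)) (walk-reverse wy))
    off′ : ∀ {w} → w ∈ C′ → col′ w ≡ nothing
    off′ w∈ = trans (old (λ { refl → ∉-remove w∈ })) (off (remove-⊆ w∈))
    coloured′ : ∀ {w} → InBoundary C′ w → ∃ λ j → col′ w ≡ just j
    coloured′ {w} b with w ≟ v
    ... | yes refl = i , refl
    ... | no w≢v = coloured (inBoundary-remove w≢v b)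
    sub : ∀ {j x} → x ≢ v → x ∈ terminals C′ col′ j → x ∈ terminals C col j
    sub {j} x≢v x∈ = let b , h = ∈-subset⁻ (terminal? C′ col′ j) x∈ in
      ∈-subset⁺ (terminal? C col j) (inBoundary-remove x≢v b , trans (≡-sym (old x≢v)) h)
    load′ : ∀ j → ∣ terminals C′ col′ j ∣ ≤ M
    load′ j with Product.≡-dec Bool._≟_ _≟_ j i
    ... | yes refl = ≤-trans (p⊆q⇒∣p∣≤∣q∣ {q = terminals C col i ∪ ⁅ v ⁆} both) (≤-trans (∣∪∣≤ (terminals C col i) ⁅ v ⁆)
          (≤-trans (≤-reflexive (trans (cong (∣ terminals C col i ∣ +_) (∣⁅x⁆∣≡1 v)) (+-comm _ 1))) light))
      where
      both : terminals C′ col′ i ⊆ terminals C col i ∪ ⁅ v ⁆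
      both {x} x∈ with x ≟ v
      ... | yes refl = q⊆p∪q (terminals C col i) _ (x∈⁅x⁆ x)
      ... | no x≢v = p⊆p∪q _ (sub x≢v x∈)
    ... | no j≢i = ≤-trans (p⊆q⇒∣p∣≤∣q∣ (λ x∈ → sub (λ { refl →
          j≢i (just-injective (trans (≡-sym (proj₂ (∈-subset⁻ (terminal? C′ col′ j) x∈))) at-v)) }) x∈)) (load j)

  -- The absorbed vertex has to touch the class, so it is a neighbour in `C` of a terminal; a class
  -- without terminals offers none and is restarted at `v`.
  grow : ∀ {C col v i} → State C col → v ∈ C → ∣ terminals C col i ∣ < M → ∃ λ u → u ∈ C × ∃ (State (C - u))
  grow {C} {col} {v} {i} st v∈C light with nonempty? (terminals C col i)
  ... | no none = v , v∈C , restart st v∈C none (≤-trans (s≤s z≤n) light)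
  ... | yes (s , s∈) = let (_ , c , c∈ , e) , h = ∈-subset⁻ (terminal? C col i) s∈ in
    c , c∈ , extend st c∈ h e light

-- Minor models of disjoint copies

packing-model : ∀ {k} {H G : Graph} (B : Fin k → Fin (n H) → Subset (n G)) →
  (∀ t p → ∃ λ x → x ∈ B t p) → (∀ t p → ConnectedIn G (λ x → x ∈ B t p)) →
  (∀ {t p t′ p′ x} → x ∈ B t p → x ∈ B t′ p′ → (t , p) ≡ (t′ , p′)) →
  (∀ t p p′ → Edge H p p′ → ∃₂ λ x y → (x ∈ B t p) × (y ∈ B t p′) × Edge G x y) →
  copies k H ≼ G
packing-model {k} {H} {G} B nonemp conn dis edge = record
  { branch = λ u → B (q u) (p u)
  ; nonempty = λ u → nonemp (q u) (p u)
  ; connected = λ u → conn (q u) (p u)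
  ; disjoint = λ u v u≢v x a b → u≢v (trans (≡-sym (combine-remQuot {k} (n H) u))
      (trans (cong (λ (t , p) → combine t p) (dis a b)) (combine-remQuot {k} (n H) v)))
  ; edges = edges′ }
  where
  q : Fin (k * n H) → Fin k
  q u = proj₁ (remQuot {k} (n H) u)
  p : Fin (k * n H) → Fin (n H)
  p u = proj₂ (remQuot {k} (n H) u)
  edges′ : ∀ u v → Edge (copies k H) u v → ∃₂ λ x y → (x ∈ B (q u) (p u)) × (y ∈ B (q v) (p v)) × Edge G x y
  edges′ u v e with q u ≟ q v
  edges′ u v e | yes h = subst (λ t → ∃₂ λ x y → (x ∈ B (q u) (p u)) × (y ∈ B t (p v)) × Edge G x y) h (edge (q u) (p u) (p v) e)
  edges′ u v () | no _

-- The saturated case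

module Saturated {G : Graph} {m M : ℕ} {C : Subset (n G)} {col : Fin (n G) → Maybe (Bool × Fin m)}
  (st : Colouring.State G m M C col) (saturated : ∀ i → M ≤ ∣ Colouring.terminals G m M C col i ∣) where
  open Colouring G m M
  open State st

  open Sides st public

  side-≥ : ∀ s → m * M ≤ ∣ side s ∣
  side-≥ s = ≤-trans (≤-trans (≤-reflexive (≡-sym (sum-const m M))) (sum-mono (λ i → saturated (s , i))))
    (card-packing (side s) (λ i → terminals C col (s , i))
      (λ i x∈ → let b , h = ∈-subset⁻ (terminal? C col (s , i)) x∈ in ∈-subset⁺ (inSide? s) (b , i , h))
      (λ {i} {j} a b → cong proj₂ (just-injective (trans (≡-sym (proj₂ (∈-subset⁻ (terminal? C col (s , i)) a)))
        (proj₂ (∈-subset⁻ (terminal? C col (s , j)) b))))))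

  Left Right : V → Set
  Left u = u ∈ C ⊎ InSide false u
  Right v = v ∈ C ⊎ InSide true v

  -- A perfect matching from Left to Right decomposes into paths through C from the one side to the other,
  -- the loops accounting for the unused vertices of C.
  Link : V → V → Set
  Link u v = Left u × Right v × (u ≡ v ⊎ Edge G u v) × (u ∈ C ⊎ v ∈ C)

  abstract
    link? : ∀ u v → Dec (Link u v)
    link? u v = (u ∈? C ⊎-dec inSide? false u) ×-dec (v ∈? C ⊎-dec inSide? true v)
      ×-dec (u ≟ v ⊎-dec edge? u v) ×-dec (u ∈? C ⊎-dec v ∈? C)

  open Bipartite Link link?
  open König könig public
  open IsMatching matching public

  loop : ∀ {c} → c ∈ C → Link c c
  loop c∈ = inj₁ c∈ , inj₁ c∈ , inj₁ refl , inj₁ c∈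

  edge-link : ∀ {u v} → Edge G u v → Left u → Right v → (u ∈ C ⊎ v ∈ C) → Link u v
  edge-link e l r c = l , r , inj₂ e , c

  module Deficient {u₀} (u₀∈ : Left u₀) (u₀-free : μ u₀ ≡ nothing) where

    -- The vertex cover dual to μ consists of the outward vertices on the left and of D on the right. Every vertex
    -- of C belongs to one of the two because of its loop, and the separator collects those that belong to both.
    Outward : V → Set
    Outward u = ∃ λ v → μ u ≡ just v × v ∉ D

    abstract
      outward? : Decidable Outward
      outward? u = any? (λ v → ≡-dec _≟_ (μ u) (just v) ×-dec ¬? (v ∈? D))

    -- The cover property: a left vertex outside the cover is free or matched into `D`, and either
    -- way its neighbours are in `D`.
    inward-closed : ∀ {u v} → ¬ Outward u → Link u v → v ∈ D
    inward-closed {u} {v} ¬out l with μ u in eq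
    ... | nothing = free-closed eq v l
    ... | just w = D-closed eq (decidable-stable (w ∈? D) (λ w∉ → ¬out (w , refl , w∉))) v l

    to-outside : ∀ {u v} → Link u v → v ∉ D → Outward u
    to-outside {u} l v∉ = decidable-stable (outward? u) (λ h → v∉ (inward-closed h l))

    -- The matching edges from `C` to right vertices outside `D`; from a vertex of the cut they lead
    -- on to the `true` side.
    σ : V → Maybe V
    σ u with u ∈? C | outward? u
    ... | yes _ | yes (v , _) = just v
    ... | yes _ | no _ = nothing
    ... | no _ | _ = nothing

    σ-just : ∀ {u v} → σ u ≡ just v → u ∈ C × μ u ≡ just v × v ∉ D
    σ-just {u} h with u ∈? C | outward? u
    σ-just refl | yes u∈ | yes (v , h , v∉) = u∈ , h , v∉
    σ-just () | yes _ | no _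
    σ-just () | no _ | _

    σ-nothing : ∀ {u} → σ u ≡ nothing → u ∈ C → ¬ Outward u
    σ-nothing {u} h u∈ out with u ∈? C | outward? u
    σ-nothing () u∈ out | yes _ | yes _
    σ-nothing h u∈ out | yes _ | no ¬out = ¬out out
    σ-nothing h u∈ out | no u∉ | _ = u∉ u∈

    σ-idle : ∀ {u} → ¬ Outward u → σ u ≡ nothing
    σ-idle {u} ¬out with σ u in eq
    ... | nothing = refl
    ... | just v = let _ , h , v∉ = σ-just eq in ⊥-elim (¬out (v , h , v∉))

    -- Matching edges into `D`, reversed; from a vertex of the cut they lead back to the `false`
    -- side.
    τ : V → Maybe V
    τ v with v ∈? C | v ∈? D
    ... | yes _ | yes v∈D = just (proj₁ (D-matched v∈D))
    ... | yes _ | no _ = nothing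
    ... | no _ | _ = nothing

    τ-just : ∀ {v u} → τ v ≡ just u → v ∈ C × v ∈ D × μ u ≡ just v
    τ-just {v} h with v ∈? C | v ∈? D
    τ-just refl | yes v∈C | yes v∈D = v∈C , v∈D , proj₂ (D-matched v∈D)
    τ-just () | yes _ | no _
    τ-just () | no _ | _

    τ-nothing : ∀ {v} → τ v ≡ nothing → v ∈ C → v ∉ D
    τ-nothing {v} h v∈ v∈D with v ∈? C | v ∈? D
    τ-nothing () v∈ v∈D | yes _ | yes _
    τ-nothing h v∈ v∈D | yes _ | no v∉D = v∉D v∈D
    τ-nothing h v∈ v∈D | no v∉ | _ = v∉ v∈

    τ-idle : ∀ {v} → v ∉ D → τ v ≡ nothing
    τ-idle {v} v∉ with τ v in eq
    ... | nothing = refl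
    ... | just u = ⊥-elim (v∉ (proj₁ (proj₂ (τ-just eq))))

    abstract
      near? : Decidable (λ v → v ∈ C × ¬ Outward v)
      near? v = v ∈? C ×-dec ¬? (outward? v)

      far? : Decidable (λ v → v ∈ C × v ∉ D)
      far? v = v ∈? C ×-dec ¬? (v ∈? D)

      cut? : Decidable (λ v → v ∈ C × v ∈ D × Outward v)
      cut? v = v ∈? C ×-dec v ∈? D ×-dec outward? v

    near far cut : Subset (n G)
    near = subset near?
    far = subset far?
    cut = subset cut?

    near-boundary : ∀ {v} → InBoundary near v → Right v → v ∈ D
    near-boundary (_ , c , c∈ , e) r = let c∈C , ¬out = ∈-subset⁻ near? c∈ in
      inward-closed ¬out (edge-link e (inj₁ c∈C) r (inj₁ c∈C))

    far-boundary : ∀ {v} → InBoundary far v → Left v → Outward v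
    far-boundary {v} (_ , c , c∈ , e) l = let c∈C , c∉D = ∈-subset⁻ far? c∈ in
      to-outside (edge-link (edge-sym {G} {c} {v} e) l (inj₁ c∈C) (inj₂ c∈C)) c∉D

    module Forward = Recolour st σ (proj₁ ∘ σ-just) (λ h → proj₁ (proj₂ (proj₂ (along (proj₁ (proj₂ (σ-just h)))))))

    forward : State near Forward.recoloured
    forward = Forward.reroute
      (λ h h′ → inj (proj₁ (proj₂ (σ-just h))) (proj₁ (proj₂ (σ-just h′))))
      (proj₁ ∘ ∈-subset⁻ near?)
      (λ v∈ → σ-idle (proj₂ (∈-subset⁻ near? v∈)))
      -- `σ` arrives only at right vertices outside `D`, whereas right vertices on the boundary of
      -- `near` lie in `D`.
      (λ b u h → let _ , μu , v∉D = σ-just h in v∉D (near-boundary b (proj₁ (proj₂ (along μu)))))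
      (λ {v} v∈ b stop → finish stop (Forward.end-invariant Inv next (n G)
        (inj₁ (v∈ , decidable-stable (outward? v) (λ ¬out → proj₁ b (∈-subset⁺ near? (v∈ , ¬out)))))))
      where
      -- A vertex of `C` outside `D` is outward because of its loop, so the chain cannot stop within
      -- `C`.
      Inv : V → Set
      Inv u = (u ∈ C × Outward u) ⊎ InSide true u
      next : ∀ {u v} → Inv u → σ u ≡ just v → Inv v
      next _ h = let _ , μu , v∉D = σ-just h in
        [ (λ v∈C → inj₁ (v∈C , to-outside (loop v∈C) v∉D)) , inj₂ ]′ (proj₁ (proj₂ (along μu)))
      finish : ∀ {u} → σ u ≡ nothing → Inv u → InBoundary C u
      finish stop (inj₁ (u∈C , out)) = ⊥-elim (σ-nothing stop u∈C out)
      finish stop (inj₂ (b , _)) = b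

    τ-inj : ∀ {v v′ u} → τ v ≡ just u → τ v′ ≡ just u → v ≡ v′
    τ-inj h h′ = just-injective (trans (≡-sym (proj₂ (proj₂ (τ-just h)))) (proj₂ (proj₂ (τ-just h′))))

    τ-adjacent : ∀ {v u} → τ v ≡ just u → v ≡ u ⊎ Edge G v u
    τ-adjacent {v} {u} h with proj₁ (proj₂ (proj₂ (along (proj₂ (proj₂ (τ-just h))))))
    ... | inj₁ refl = inj₁ refl
    ... | inj₂ e = inj₂ (edge-sym {G} {u} {v} e)

    module Backward = Recolour st τ (proj₁ ∘ τ-just) τ-adjacent

    Trace : V → Set
    Trace u = (u ∈ C × u ∈ D) ⊎ InSide false u

    trace-next : ∀ {v u} → Trace v → τ v ≡ just u → Trace u
    trace-next _ h = let _ , v∈D , μu = τ-just h in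
      [ (λ u∈C → inj₁ (u∈C , D-closed μu v∈D _ (loop u∈C))) , inj₂ ]′ (proj₁ (along μu))

    trace-finish : ∀ {u} → τ u ≡ nothing → Trace u → InSide false u
    trace-finish stop (inj₁ (u∈C , u∈D)) = ⊥-elim (τ-nothing stop u∈C u∈D)
    trace-finish stop (inj₂ s) = s

    outward-source : ∀ {v} → Outward v → Backward.Source v
    outward-source (w , μv , w∉D) u h = let _ , u∈D , μv′ = τ-just h in
      w∉D (subst (_∈ D) (just-injective (trans (≡-sym μv′) μv)) u∈D)

    backward : State far Backward.recoloured
    backward = Backward.reroute τ-inj
      (proj₁ ∘ ∈-subset⁻ far?)
      (λ v∈ → τ-idle (proj₂ (∈-subset⁻ far? v∈)))
      (λ b u h → outward-source (far-boundary b (proj₁ (along (proj₂ (proj₂ (τ-just h)))))) u h)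
      (λ {v} v∈ b stop → proj₁ (trace-finish stop (Backward.end-invariant Trace trace-next (n G)
        (inj₁ (v∈ , decidable-stable (v ∈? D) (λ v∉D → proj₁ b (∈-subset⁺ far? (v∈ , v∉D))))))))

    cut-≤ : ∣ cut ∣ ≤ m * M
    cut-≤ = ≤-trans (card-injection cut (side false) (Backward.end (n G))
        (λ v∈ → let v∈C , v∈D , out = ∈-subset⁻ cut? v∈ in
          ∈-subset⁺ (inSide? false) (trace-finish (B.end-maximal (outward-source out))
            (Backward.end-invariant Trace trace-next (n G) (inj₁ (v∈C , v∈D)))))
        (λ u∈ v∈ → B.end-injective (n G)
          (outward-source (proj₂ (proj₂ (∈-subset⁻ cut? u∈)))) (outward-source (proj₂ (proj₂ (∈-subset⁻ cut? v∈))))))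
      (side-≤ false)
      where module B = Backward.Injective τ-inj

    -- Either `u₀` itself or a neighbour of it in `C` lies in `D` and is therefore missing from
    -- `far`.
    far-< : ∣ far ∣ < ∣ C ∣
    far-< = let c , c∈C , c∈D = witness u₀∈ in
      ∣∣<-strict (proj₁ ∘ ∈-subset⁻ far?) c∈C (λ c∈ → proj₂ (∈-subset⁻ far? c∈) c∈D)
      where
      witness : Left u₀ → ∃ λ c → c ∈ C × c ∈ D
      witness (inj₁ u₀∈C) = u₀ , u₀∈C , free-closed u₀-free _ (loop u₀∈C)
      witness (inj₂ s@((_ , c , c∈C , e) , _)) = c , c∈C ,
        free-closed u₀-free c (edge-link (edge-sym {G} {c} {u₀} e) (inj₂ s) (inj₁ c∈C) (inj₂ c∈C))

    -- If no vertex of `C` were outward, `D` would contain `C` and the whole `true` side, and the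
    -- matching would send these injectively to left vertices other than `u₀`. By saturation the
    -- `true` side is at least as large as the `false` side, a contradiction.
    near-< : ∣ near ∣ < ∣ C ∣
    near-< with any? (λ c → c ∈? C ×-dec outward? c)
    ... | yes (c , c∈C , out) = ∣∣<-strict (proj₁ ∘ ∈-subset⁻ near?) c∈C (λ c∈ → proj₂ (∈-subset⁻ near? c∈) out)
    ... | no none = ⊥-elim (<-irrefl refl (begin-strict
        ∣ C ∣ + m * M                     ≤⟨ +-monoʳ-≤ ∣ C ∣ (side-≥ true) ⟩
        ∣ C ∣ + ∣ side true ∣             ≤⟨ ∪-disjoint-≤ C (side true) (λ c∈ s∈ → proj₁ (proj₁ (∈-subset⁻ (inSide? true) s∈)) c∈) ⟩
        ∣ C ∪ side true ∣                 ≤⟨ card-injection (C ∪ side true) ((C ∪ side false) - u₀) partner into partner-inj ⟩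
        ∣ (C ∪ side false) - u₀ ∣         <⟨ x∈p⇒∣p-x∣<∣p∣ (left⁺ u₀∈) ⟩
        ∣ C ∪ side false ∣                ≤⟨ ∣∪∣≤ C (side false) ⟩
        ∣ C ∣ + ∣ side false ∣            ≤⟨ +-monoʳ-≤ ∣ C ∣ (side-≤ false) ⟩
        ∣ C ∣ + m * M                     ∎))
      where
      open ≤-Reasoning
      left⁺ : ∀ {u} → Left u → u ∈ C ∪ side false
      left⁺ (inj₁ u∈) = p⊆p∪q _ u∈
      left⁺ (inj₂ s) = q⊆p∪q C _ (∈-subset⁺ (inSide? false) s)
      all-in-D : ∀ {v} → v ∈ C ∪ side true → v ∈ D
      all-in-D v∈ with x∈p∪q⁻ C (side true) v∈
      ... | inj₁ v∈C = inward-closed (λ out → none (_ , v∈C , out)) (loop v∈C)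
      ... | inj₂ v∈S = let s@((_ , c , c∈C , e) , _) = ∈-subset⁻ (inSide? true) v∈S in
        inward-closed (λ out → none (c , c∈C , out)) (edge-link e (inj₁ c∈C) (inj₂ s) (inj₁ c∈C))
      partner : V → V
      partner v with v ∈? D
      ... | yes v∈D = proj₁ (D-matched v∈D)
      -- An arbitrary value: only the partners of vertices in `D` matter.
      ... | no _ = v
      partner-matched : ∀ {v} → v ∈ D → μ (partner v) ≡ just v
      partner-matched {v} v∈ with v ∈? D
      ... | yes v∈D = proj₂ (D-matched v∈D)
      ... | no v∉ = ⊥-elim (v∉ v∈)
      into : ∀ {v} → v ∈ C ∪ side true → partner v ∈ (C ∪ side false) - u₀
      into v∈ = let h = partner-matched (all-in-D v∈) in
        x∈p∧x≢y⇒x∈p-y (left⁺ (proj₁ (along h))) (λ e → just≢nothing h (trans (cong μ e) u₀-free))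
      partner-inj : ∀ {v w} → v ∈ C ∪ side true → w ∈ C ∪ side true → partner v ≡ partner w → v ≡ w
      partner-inj v∈ w∈ e = just-injective (trans (≡-sym (partner-matched (all-in-D v∈)))
        (trans (cong μ e) (partner-matched (all-in-D w∈))))

    separator : Subset (n G)
    separator = boundary C ∪ cut

    separator-≤ : ∣ separator ∣ ≤ 3 * (m * M)
    separator-≤ = begin
      ∣ boundary C ∪ cut ∣      ≤⟨ ∣∪∣≤ (boundary C) cut ⟩
      ∣ boundary C ∣ + ∣ cut ∣  ≤⟨ +-mono-≤ boundary-≤ cut-≤ ⟩
      2 * (m * M) + m * M       ≡⟨ +-comm (2 * (m * M)) (m * M) ⟩
      3 * (m * M)               ∎
      where open ≤-Reasoning

    boundary-near : boundary near ⊆ separator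
    boundary-near {v} v∈ with ∈-subset⁻ (inBoundary? near) v∈ | v ∈? C
    ... | b@(v∉ , c , c∈ , e) | no v∉C =
      p⊆p∪q _ (∈-subset⁺ (inBoundary? C) (v∉C , c , proj₁ (∈-subset⁻ near? c∈) , e))
    ... | b@(v∉ , _) | yes v∈C = q⊆p∪q (boundary C) _ (∈-subset⁺ cut? (v∈C , near-boundary b (inj₁ v∈C) ,
      decidable-stable (outward? v) (λ ¬out → v∉ (∈-subset⁺ near? (v∈C , ¬out)))))

    boundary-far : boundary far ⊆ separator
    boundary-far {v} v∈ with ∈-subset⁻ (inBoundary? far) v∈ | v ∈? C
    ... | b@(v∉ , c , c∈ , e) | no v∉C =
      p⊆p∪q _ (∈-subset⁺ (inBoundary? C) (v∉C , c , proj₁ (∈-subset⁻ far? c∈) , e))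
    ... | b@(v∉ , _) | yes v∈C = q⊆p∪q (boundary C) _ (∈-subset⁺ cut? (v∈C ,
      decidable-stable (v ∈? D) (λ v∉D → v∉ (∈-subset⁺ far? (v∈C , v∉D))) , far-boundary b (inj₁ v∈C)))

    separate : ∀ {B w} → 3 * (m * M) ≤ w → boundary C ⊆ B → Elim G w separator near → Elim G w separator far → Elim G w B C
    separate {B} w≥ C⊆B e₁ e₂ = split separator near far (≤-trans separator-≤ w≥)
      (λ x∈ → [ inj₂ ∘ C⊆B , inj₁ ∘ proj₁ ∘ ∈-subset⁻ cut? ]′ (x∈p∪q⁻ (boundary C) cut x∈))
      (λ x∈C y∉C e → p⊆p∪q _ (∈-subset⁺ (inBoundary? C) (y∉C , _ , x∈C , e)))
      cover
      (proj₁ ∘ ∈-subset⁻ near?) (proj₁ ∘ ∈-subset⁻ far?)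
      (λ x∈ s → let x∈C , ¬out = ∈-subset⁻ near? x∈ in off-separator x∈C (λ z → ¬out (proj₂ (proj₂ z))) s)
      (λ x∈ s → let x∈C , x∉D = ∈-subset⁻ far? x∈ in off-separator x∈C (λ z → x∉D (proj₁ (proj₂ z))) s)
      -- Disjointness comes from the loop: a vertex of `C` that is not outward lies in `D`.
      (λ x∈ x∈′ → let x∈C , ¬out = ∈-subset⁻ near? x∈ in
        proj₂ (∈-subset⁻ far? x∈′) (inward-closed ¬out (loop x∈C)))
      e₁ e₂
      where
      off-separator : ∀ {x} → x ∈ C → ¬ (x ∈ C × x ∈ D × Outward x) → x ∉ separator
      off-separator x∈C ¬cut s with x∈p∪q⁻ (boundary C) cut s
      ... | inj₁ b = proj₁ (∈-subset⁻ (inBoundary? C) b) x∈C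
      ... | inj₂ z = ¬cut (∈-subset⁻ cut? z)
      cover : ∀ {x} → x ∈ C → x ∈ separator ⊎ x ∈ near ⊎ x ∈ far
      cover {x} x∈C with outward? x | x ∈? D
      ... | no ¬out | _ = inj₂ (inj₁ (∈-subset⁺ near? (x∈C , ¬out)))
      ... | yes _ | no x∉D = inj₂ (inj₂ (∈-subset⁺ far? (x∈C , x∉D)))
      ... | yes out | yes x∈D = inj₁ (q⊆p∪q (boundary C) _ (∈-subset⁺ cut? (x∈C , x∈D , out)))

-- Copies of K_{2,r} from a perfect matching

module Perfect {G : Graph} {m M : ℕ} {C : Subset (n G)} {col : Fin (n G) → Maybe (Bool × Fin m)}
  (st : Colouring.State G m M C col) (saturated : ∀ i → M ≤ ∣ Colouring.terminals G m M C col i ∣)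
  (perfect : ∀ {u} → Saturated.Left st saturated u → ∃ λ v → Saturated.μ st saturated u ≡ just v) where
  open Colouring G m M
  open Saturated st saturated
  open State st

  succ : V → V
  succ u = maybe′ id u (μ u)

  μ-succ : ∀ {u} → Left u → μ u ≡ just (succ u)
  μ-succ {u} l with μ u | perfect l
  ... | just v | _ = refl
  ... | nothing | _ , ()

  succ-link : ∀ {u} → Left u → Link u (succ u)
  succ-link l = along (μ-succ l)

  succ-injective : ∀ {u v} → Left u → Left v → succ u ≡ succ v → u ≡ v
  succ-injective l l′ e = inj (μ-succ l) (trans (μ-succ l′) (cong just (≡-sym e)))

  -- A link has an end in `C`, so a path cannot jump from one side straight to the other and always
  -- has an inner vertex.
  succ-∈ : ∀ {x} → InSide false x → succ x ∈ C
  succ-∈ s with proj₂ (proj₂ (proj₂ (succ-link (inj₂ s))))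
  ... | inj₁ x∈ = ⊥-elim (proj₁ (proj₁ s) x∈)
  ... | inj₂ h = h

  succ-edge : ∀ {x} → InSide false x → Edge G x (succ x)
  succ-edge {x} s with proj₁ (proj₂ (proj₂ (succ-link (inj₂ s))))
  ... | inj₁ e = ⊥-elim (proj₁ (proj₁ s) (subst (_∈ C) (≡-sym e) (succ-∈ s)))
  ... | inj₂ h = h

  succ² : V → V
  succ² = succ ∘ succ

  succ²-edge : ∀ {x} → InSide false x → Edge G (succ x) (succ² x)
  succ²-edge {x} s with proj₁ (proj₂ (proj₂ (succ-link (inj₁ (succ-∈ s)))))
  ... | inj₁ e = ⊥-elim (proj₁ (proj₁ s) (subst (_∈ C)
    (≡-sym (succ-injective (inj₂ s) (inj₁ (succ-∈ s)) e)) (succ-∈ s)))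
  ... | inj₂ h = h

  -- The first inner vertex of each path; these will be the vertices of degree two in the copies of K_{2,r}.
  Mid : V → Set
  Mid v = ∃ λ x → InSide false x × succ x ≡ v

  abstract
    mid? : Decidable Mid
    mid? v = any? (λ x → inSide? false x ×-dec succ x ≟ v)

  inner-not-mid : ∀ {u} → u ∈ C → ¬ Mid (succ u)
  inner-not-mid u∈ (x , s , e) = proj₁ (proj₁ s)
    (subst (_∈ C) (≡-sym (succ-injective (inj₂ s) (inj₁ u∈) e)) u∈)

  -- Each path is cut behind its first inner vertex. That vertex stays uncoloured, while the rest of
  -- the path joins the class at its end on the `true` side.
  f : V → Maybe V
  f u with u ∈? C | mid? u
  ... | yes _ | no _ = just (succ u)
  ... | yes _ | yes _ = nothing
  ... | no _ | _ = nothing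

  f-just : ∀ {u v} → f u ≡ just v → u ∈ C × ¬ Mid u × succ u ≡ v
  f-just {u} h with u ∈? C | mid? u
  f-just refl | yes u∈ | no ¬mid = u∈ , ¬mid , refl
  f-just () | yes _ | yes _
  f-just () | no _ | _

  f-nothing : ∀ {u} → f u ≡ nothing → u ∈ C → Mid u
  f-nothing {u} h u∈ with u ∈? C | mid? u
  f-nothing () u∈ | yes _ | no _
  f-nothing h u∈ | yes _ | yes mid = mid
  f-nothing h u∈ | no u∉ | _ = ⊥-elim (u∉ u∈)

  f-mid : ∀ {u} → Mid u → f u ≡ nothing
  f-mid {u} mid with f u in eq
  ... | nothing = refl
  ... | just v = ⊥-elim (proj₁ (proj₂ (f-just eq)) mid)

  f-adjacent : ∀ {u v} → f u ≡ just v → u ≡ v ⊎ Edge G u v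
  f-adjacent h with f-just h
  ... | u∈ , _ , refl = proj₁ (proj₂ (proj₂ (succ-link (inj₁ u∈))))

  f-inj : ∀ {u u′ v} → f u ≡ just v → f u′ ≡ just v → u ≡ u′
  f-inj h h′ = let u∈ , _ , e = f-just h ; u′∈ , _ , e′ = f-just h′ in
    succ-injective (inj₁ u∈) (inj₁ u′∈) (trans e (≡-sym e′))

  open Recolour st f (proj₁ ∘ f-just) f-adjacent
  module F = Injective f-inj

  Trail : V → Set
  Trail u = (u ∈ C × ¬ Mid u) ⊎ InSide true u

  trail : ∀ {u} → u ∈ C → Trail (succ u)
  trail u∈ = [ (λ h → inj₁ (h , inner-not-mid u∈)) , inj₂ ]′ (proj₁ (proj₂ (succ-link (inj₁ u∈))))

  trail-next : ∀ {u v} → Trail u → f u ≡ just v → Trail v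
  trail-next _ h with f-just h
  ... | u∈ , _ , refl = trail u∈

  trail-finish : ∀ {u} → f u ≡ nothing → Trail u → InSide true u
  trail-finish stop (inj₁ (u∈ , ¬mid)) = ⊥-elim (¬mid (f-nothing stop u∈))
  trail-finish stop (inj₂ s) = s

  -- By injectivity only `succ x` could precede `succ² x`, and as a middle vertex it has lost its
  -- arrow.
  succ²-source : ∀ {x} → InSide false x → Source (succ² x)
  succ²-source {x} s u h = let u∈ , ¬mid , e = f-just h in
    ¬mid (x , s , ≡-sym (succ-injective (inj₁ u∈) (inj₁ (succ-∈ s)) e))

  lands : ∀ {x} → InSide false x → InSide true (end (n G) (succ² x))
  lands s = trail-finish (F.end-maximal (succ²-source s)) (end-invariant Trail trail-next (n G) (trail (succ-∈ s)))

  landing-injective : ∀ {x y} → InSide false x → InSide false y → end (n G) (succ² x) ≡ end (n G) (succ² y) → x ≡ y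
  landing-injective s s′ e = succ-injective (inj₂ s) (inj₂ s′)
    (succ-injective (inj₁ (succ-∈ s)) (inj₁ (succ-∈ s′)) (F.end-injective (n G) (succ²-source s) (succ²-source s′) e))

  Joins : Fin m → Fin m → V → Set
  Joins i j x = InSide false x × col x ≡ just (false , i) × recoloured (succ² x) ≡ just (true , j)

  abstract
    joins? : ∀ i j → Decidable (Joins i j)
    joins? i j x = inSide? false x ×-dec (col x ≟ᶜ just (false , i)) ×-dec (recoloured (succ² x) ≟ᶜ just (true , j))

    reaches? : ∀ j → Decidable (λ x → InSide false x × recoloured (succ² x) ≡ just (true , j))
    reaches? j x = inSide? false x ×-dec (recoloured (succ² x) ≟ᶜ just (true , j))

  paths : Fin m → Fin m → Subset (n G)
  paths i j = subset (joins? i j)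

  row : ∀ i → sum (λ j → ∣ paths i j ∣) ≤ M
  row i = ≤-trans
    (card-packing (terminals C col (false , i)) (paths i)
      (λ j x∈ → let s , h , _ = ∈-subset⁻ (joins? i j) x∈ in ∈-subset⁺ (terminal? C col (false , i)) (proj₁ s , h))
      (λ {j} {j′} a b → cong proj₂ (just-injective (trans (≡-sym (proj₂ (proj₂ (∈-subset⁻ (joins? i j) a))))
        (proj₂ (proj₂ (∈-subset⁻ (joins? i j′) b)))))))
    (load (false , i))

  -- Paths are counted where they land, and different paths land at different terminals of the
  -- class.
  column : ∀ j → sum (λ i → ∣ paths i j ∣) ≤ M
  column j = ≤-trans
    (card-packing (subset (reaches? j)) (λ i → paths i j)
      (λ i x∈ → let s , _ , h = ∈-subset⁻ (joins? i j) x∈ in ∈-subset⁺ (reaches? j) (s , h))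
      (λ {i} {i′} a b → cong proj₂ (just-injective (trans (≡-sym (proj₁ (proj₂ (∈-subset⁻ (joins? i j) a))))
        (proj₁ (proj₂ (∈-subset⁻ (joins? i′ j) b)))))))
    (≤-trans
      (card-injection (subset (reaches? j)) (terminals C col (true , j)) (λ x → end (n G) (succ² x))
        (λ x∈ → let s , h = ∈-subset⁻ (reaches? j) x∈ in ∈-subset⁺ (terminal? C col (true , j)) (proj₁ (lands s) , h))
        (λ x∈ y∈ → landing-injective (proj₁ (∈-subset⁻ (reaches? j) x∈)) (proj₁ (∈-subset⁻ (reaches? j) y∈))))
      (load (true , j)))

  total : m * M ≤ sum (λ i → sum (λ j → ∣ paths i j ∣))
  total = ≤-trans (≤-reflexive (≡-sym (sum-const m M))) (sum-mono (λ i →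
    ≤-trans (saturated (false , i)) (card-cover (terminals C col (false , i)) (paths i) (λ x∈ →
      let b , h = ∈-subset⁻ (terminal? C col (false , i)) x∈
          s = b , i , h
          _ , j , h′ = lands s
      in j , ∈-subset⁺ (joins? i j) (s , h , h′)))))

  model : ∀ k ρ → (∀ j → j < k → j * (M + M) + (m ∸ j) * ((m ∸ j) * ρ) < m * M) → copies k (K2 (suc ρ)) ≼ G
  model k ρ big with heavy-transversal k m (λ i j → ∣ paths i j ∣) row column (λ j j<k → <-≤-trans (big j j<k) total)
  ... | a , b , a-inj , b-inj , heavy = packing-model {k} {K2 r} {G} branch nonempty connected′ disjoint edge
    where
    r = suc ρ
    x : Fin k → Fin r → V
    x t = proj₁ (pick (paths (a t) (b t)) (heavy t))
    x-inj : ∀ t {l l′} → x t l ≡ x t l′ → l ≡ l′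
    x-inj t = proj₁ (proj₂ (pick (paths (a t) (b t)) (heavy t)))
    x-joins : ∀ t l → Joins (a t) (b t) (x t l)
    x-joins t l = ∈-subset⁻ (joins? (a t) (b t)) (proj₂ (proj₂ (pick (paths (a t) (b t)) (heavy t))) l)

    -- The two hubs are recoloured classes, one from each side; the vertices of degree two are
    -- single middle vertices, which no class contains.
    InBranch : Fin k → Fin (suc (suc r)) → V → Set
    InBranch t zero v = recoloured v ≡ just (false , a t)
    InBranch t (suc zero) v = recoloured v ≡ just (true , b t)
    InBranch t (suc (suc l)) v = v ≡ succ (x t l)

    abstract
      inBranch? : ∀ t p → Decidable (InBranch t p)
      inBranch? t zero v = recoloured v ≟ᶜ _
      inBranch? t (suc zero) v = recoloured v ≟ᶜ _
      inBranch? t (suc (suc l)) v = v ≟ _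

    branch : Fin k → Fin (suc (suc r)) → Subset (n G)
    branch t p = subset (inBranch? t p)

    member : ∀ t p → ∃ (InBranch t p)
    member t zero = x t zero , recoloured-old (proj₁ (proj₂ (x-joins t zero)))
    member t (suc zero) = succ² (x t zero) , proj₂ (proj₂ (x-joins t zero))
    member t (suc (suc l)) = succ (x t l) , refl

    nonempty : ∀ t p → ∃ λ v → v ∈ branch t p
    nonempty t p = let v , h = member t p in v , ∈-subset⁺ (inBranch? t p) h

    joined : ∀ t p → ConnectedIn G (InBranch t p)
    joined t zero = recoloured-connected _
    joined t (suc zero) = recoloured-connected _
    joined t (suc (suc l)) v w refl refl = here refl

    connected′ : ∀ t p → ConnectedIn G (λ v → v ∈ branch t p)
    connected′ t p v w v∈ w∈ = walk-map id id (∈-subset⁺ (inBranch? t p))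
      (joined t p v w (∈-subset⁻ (inBranch? t p) v∈) (∈-subset⁻ (inBranch? t p) w∈))

    uncoloured : ∀ t l → recoloured (succ (x t l)) ≡ nothing
    uncoloured t l = let s = proj₁ (x-joins t l) in
      trans (recoloured-off (f-mid (x t l , s , refl))) (off (succ-∈ s))

    same-source : ∀ t l t′ l′ → x t l ≡ x t′ l′ → (t , suc (suc l)) ≡ (t′ , suc (suc l′))
    same-source t l t′ l′ e with a-inj (cong proj₂ (just-injective (trans (≡-sym (proj₁ (proj₂ (x-joins t l))))
      (trans (cong col e) (proj₁ (proj₂ (x-joins t′ l′)))))))
    ... | refl = cong (λ l → t , suc (suc l)) (x-inj t e)

    unique : ∀ t p t′ p′ {v} → InBranch t p v → InBranch t′ p′ v → (t , p) ≡ (t′ , p′)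
    unique t zero t′ zero h h′ with a-inj (cong proj₂ (just-injective (trans (≡-sym h) h′)))
    ... | refl = refl
    unique t (suc zero) t′ (suc zero) h h′ with b-inj (cong proj₂ (just-injective (trans (≡-sym h) h′)))
    ... | refl = refl
    unique t zero t′ (suc zero) h h′ = contradiction (trans (≡-sym h) h′) λ ()
    unique t (suc zero) t′ zero h h′ = contradiction (trans (≡-sym h) h′) λ ()
    unique t zero t′ (suc (suc l)) h refl = contradiction (uncoloured t′ l) (just≢nothing h)
    unique t (suc zero) t′ (suc (suc l)) h refl = contradiction (uncoloured t′ l) (just≢nothing h)
    unique t (suc (suc l)) t′ zero refl h = contradiction (uncoloured t l) (just≢nothing h)
    unique t (suc (suc l)) t′ (suc zero) refl h = contradiction (uncoloured t l) (just≢nothing h)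
    unique t (suc (suc l)) t′ (suc (suc l′)) h h′ = same-source t l t′ l′
      (succ-injective (inj₂ (proj₁ (x-joins t l))) (inj₂ (proj₁ (x-joins t′ l′))) (trans (≡-sym h) h′))

    disjoint : ∀ {t p t′ p′ v} → v ∈ branch t p → v ∈ branch t′ p′ → (t , p) ≡ (t′ , p′)
    disjoint {t} {p} {t′} {p′} v∈ v∈′ = unique t p t′ p′ (∈-subset⁻ (inBranch? t p) v∈) (∈-subset⁻ (inBranch? t′ p′) v∈′)

    Joined : Fin k → Fin (suc (suc r)) → Fin (suc (suc r)) → Set
    Joined t p p′ = ∃₂ λ v w → (v ∈ branch t p) × (w ∈ branch t p′) × Edge G v w

    flip : ∀ {t p p′} → Joined t p p′ → Joined t p′ p
    flip (v , w , v∈ , w∈ , e) = w , v , w∈ , v∈ , edge-sym {G} {v} {w} e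

    left-mid : ∀ t l → Joined t zero (suc (suc l))
    left-mid t l = let s , h , _ = x-joins t l in x t l , succ (x t l) ,
      ∈-subset⁺ (inBranch? t zero) (recoloured-old h) , ∈-subset⁺ (inBranch? t (suc (suc l))) refl , succ-edge s

    mid-right : ∀ t l → Joined t (suc (suc l)) (suc zero)
    mid-right t l = let s , _ , h = x-joins t l in succ (x t l) , succ² (x t l) ,
      ∈-subset⁺ (inBranch? t (suc (suc l))) refl , ∈-subset⁺ (inBranch? t (suc zero)) h , succ²-edge s

    edge : ∀ t p p′ → Edge (K2 r) p p′ → Joined t p p′
    edge t zero (suc (suc l)) _ = left-mid t l
    edge t (suc zero) (suc (suc l)) _ = flip (mid-right t l)
    edge t (suc (suc l)) zero _ = flip (left-mid t l)
    edge t (suc (suc l)) (suc zero) _ = mid-right t l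
    edge t zero zero ()
    edge t zero (suc zero) ()
    edge t (suc zero) zero ()
    edge t (suc zero) (suc zero) ()
    edge t (suc (suc l)) (suc (suc l′)) ()

-- The decomposition

module Decompose (G : Graph) (m M k ρ : ℕ) (no-model : ¬ (copies k (K2 (suc ρ)) ≼ G))
  (1≤mM : 1 ≤ m * M) (big : ∀ j → j < k → j * (M + M) + (m ∸ j) * ((m ∸ j) * ρ) < m * M) where
  open Colouring G m M

  w : ℕ
  w = 3 * (m * M)

  -- A split whose second part is empty. Its bag has at most 2mM + 1 vertices, which `1≤mM` brings
  -- to at most 3mM.
  remove : ∀ {B C col u} → State C col → u ∈ C → boundary C ⊆ B →
    Elim G w (boundary C ∪ ⁅ u ⁆) (C - u) → Elim G w B C
  remove {B} {C} {u = u} st u∈C ⊆B e = split (insert (boundary C) u) (C - u) ⊥ size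
    (λ x∈ → [ inj₂ ∘ ⊆B , (λ { refl → inj₁ u∈C }) ]′ (insert⁻ x∈))
    (λ x∈C y∉C e → ⊆-insert (∈-subset⁺ (inBoundary? C) (y∉C , _ , x∈C , e)))
    cover remove-⊆ (⊥-elim ∘ ∉⊥)
    (λ x∈ b → [ (λ x∈∂ → proj₁ (∈-subset⁻ (inBoundary? C) x∈∂) (remove-⊆ x∈))
              , (λ { refl → ∉-remove x∈ }) ]′ (insert⁻ b))
    (⊥-elim ∘ ∉⊥) (λ _ → ∉⊥) e (done (λ (_ , h) → ∉⊥ h))
    where
    size : ∣ insert (boundary C) u ∣ ≤ w
    size = begin
      ∣ boundary C ∪ ⁅ u ⁆ ∣       ≤⟨ ∣∪∣≤ (boundary C) ⁅ u ⁆ ⟩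
      ∣ boundary C ∣ + ∣ ⁅ u ⁆ ∣   ≤⟨ +-mono-≤ (Sides.boundary-≤ st) (≤-trans (≤-reflexive (∣⁅x⁆∣≡1 u)) 1≤mM) ⟩
      2 * (m * M) + m * M          ≡⟨ +-comm (2 * (m * M)) (m * M) ⟩
      w                            ∎
      where open ≤-Reasoning
    cover : ∀ {x} → x ∈ C → x ∈ insert (boundary C) u ⊎ x ∈ C - u ⊎ x ∈ ⊥
    cover {x} x∈C with x ≟ u
    ... | yes refl = inj₁ ∈-insert
    ... | no x≢u = inj₂ (inj₁ (x∈p∧x≢y⇒x∈p-y x∈C x≢u))

  boundary-remove : ∀ {C u} → boundary (C - u) ⊆ insert (boundary C) u
  boundary-remove {C} {u} {v} v∈ with v ≟ u | ∈-subset⁻ (inBoundary? (C - u)) v∈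
  ... | yes refl | _ = ∈-insert
  ... | no v≢u | b = ⊆-insert (∈-subset⁺ (inBoundary? C) (inBoundary-remove v≢u b))

  light? : ∀ C (col : V → Maybe Colour) → (∃ λ i → ∣ terminals C col i ∣ < M) ⊎ (∀ i → M ≤ ∣ terminals C col i ∣)
  light? C col with any? (λ i → suc ∣ terminals C col (false , i) ∣ ≤? M) | any? (λ i → suc ∣ terminals C col (true , i) ∣ ≤? M)
  ... | yes (i , h) | _ = inj₁ ((false , i) , h)
  ... | no _ | yes (i , h) = inj₁ ((true , i) , h)
  ... | no no₀ | no no₁ = inj₂ λ { (false , i) → ≮⇒≥ (λ h → no₀ (i , h)) ; (true , i) → ≮⇒≥ (λ h → no₁ (i , h)) }

  -- Recursion on the size of `C`. `B` may exceed the boundary: after a split the parent bag is the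
  -- whole separator, of which a part may touch only some vertices.
  decompose : ∀ size {B C col} → ∣ C ∣ ≤ size → State C col → boundary C ⊆ B → Elim G w B C
  decompose size {B} {C} {col} C≤ st ⊆B with nonempty? C
  ... | no none = done none
  decompose zero {C = C} C≤ st ⊆B | yes (v , v∈) = contradiction C≤ (<⇒≱ (≤-<-trans z≤n (x∈p⇒∣p-x∣<∣p∣ v∈)))
  decompose (suc size) {B} {C} {col} C≤ st ⊆B | yes (v , v∈) with light? C col
  ... | inj₁ (i , light) = let u , u∈C , col′ , st′ = grow st v∈ light in
    remove st u∈C ⊆B
      (decompose size (≤-pred (≤-trans (x∈p⇒∣p-x∣<∣p∣ u∈C) C≤)) st′ boundary-remove)
  ... | inj₂ saturated with any? (λ u → (u ∈? C ⊎-dec Sides.inSide? st false u) ×-dec ≡-dec _≟_ (Saturated.μ st saturated u) nothing)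
  ...   | yes (u₀ , u₀∈ , free) = separate ≤-refl ⊆B
    (decompose size (≤-pred (≤-trans near-< C≤)) forward boundary-near)
    (decompose size (≤-pred (≤-trans far-< C≤)) backward boundary-far)
    where open Saturated.Deficient st saturated u₀∈ free
  ...   | no none = ⊥-elim (no-model (Perfect.model st saturated (λ l → ≢nothing⇒just (λ e → none (_ , l , e))) k ρ big))

  -- With all vertices still to be decomposed there is no boundary, so all classes can start empty.
  uncoloured-state : State ⊤ (λ _ → nothing)
  uncoloured-state = record
    { connected = λ i x y () ; off = λ _ → refl ; coloured = λ (v∉ , _) → ⊥-elim (v∉ ∈⊤)
    ; load = λ i → ≤-trans (≤-reflexive (trans (cong ∣_∣ (Empty-unique
        (λ (_ , h) → proj₁ (proj₁ (∈-subset⁻ (terminal? ⊤ (λ _ → nothing) i) h)) ∈⊤))) (∣⊥∣≡0 (n G)))) z≤n }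

  decomposition : Elim G w ⊥ ⊤
  decomposition = decompose ∣ ⊤ {n G} ∣ ≤-refl uncoloured-state (λ v∈ → ⊥-elim (proj₁ (∈-subset⁻ (inBoundary? ⊤) v∈) ∈⊤))

theorem4 : (r k : ℕ) → 1 ≤ r → 1 ≤ k → (G : Graph) →
    ¬ (copies k (K2 r) ≼ G) →
    TreewidthLessThan G (20 * k * k * r * r ∸ 8 * k * k * r + 2 * r ∸ 1)
theorem4 zero k () 1≤k G no-model
theorem4 (suc ρ) k 1≤r 1≤k G no-model =
  elim-treewidth decomposition (width-arith k ρ 1≤k)
    (≤-trans (*-mono-≤ {1} {3} (s≤s z≤n) 1≤mM) (width-arith k ρ 1≤k))
  where
  1≤mM : 1 ≤ 3 * k * (4 * k * ρ + 1)
  1≤mM = *-mono-≤ {1} (*-mono-≤ {1} {3} (s≤s z≤n) 1≤k) (m≤n+m 1 (4 * k * ρ))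
  open Decompose G (3 * k) (4 * k * ρ + 1) k ρ no-model 1≤mM (transversal-arith k ρ)
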